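{- For every integer $k \ge 1$, every outer min-$k$-planar graph has treewidth at most $3k+1$.
   Context: A convex drawing of a finite simple graph $G$ places the vertices of $G$ at distinct points of a circle and draws every edge as a straight-line segment. A convex drawing is outer min-$k$-planar if for every pair of crossing edges, at least one of the two edges is crossed by at most $k$ edges in total. A graph is outer min-$k$-planar if it admits an outer min-$k$-planar drawing. -}

module Defs where

open import Data.Nat using (ℕ; zero; suc; _+_; _≤_)
open import Data.Fin using (Fin; zero; suc; toℕ; inject₁; fromℕ; _<?_)
open import Data.Bool using (Bool; true; false; _∧_; _xor_; not)
open import Data.List using (List; length; filterᵇ; allFin; concatMap; map)
open import Data.Product using (Σ; ∃; _×_; _,_)
open import Data.Sum using (_⊎_)
open import Data.Empty using (⊥)
open import Data.Unit using (⊤)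
open import Relation.Nullary.Decidable using (⌊_⌋)
open import Relation.Binary.PropositionalEquality using (_≡_)
open import Function.Definitions using (Injective)

record Graph (n : ℕ) : Set where
  field
    adj    : Fin n → Fin n → Bool
    sym    : ∀ u v → adj u v ≡ adj v u
    irrefl : ∀ u → adj u u ≡ false
open Graph public

countᵇ : {n : ℕ} → (Fin n → Bool) → ℕ
countᵇ {n} p = length (filterᵇ p (allFin n))

-- Convex drawings.
-- A convex drawing is determined (as far as crossings are concerned) by
-- the cyclic order of the vertices on the circle; we record it as an
-- injective map  pos : Fin n → Fin n  (vertex v is the pos v-th point in
-- clockwise order around the circle).

record ConvexDrawing (n : ℕ) : Set where
  field
    pos     : Fin n → Fin n
    pos-inj : Injective _≡_ _≡_ pos
open ConvexDrawing public

strictlyBetween : {n : ℕ} → Fin n → Fin n → Fin n → Bool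
strictlyBetween p q r =
  (⌊ p <? r ⌋ ∧ ⌊ r <? q ⌋) xor (⌊ q <? r ⌋ ∧ ⌊ r <? p ⌋)

eqᵇ : {n : ℕ} → Fin n → Fin n → Bool
eqᵇ x y = not (⌊ x <? y ⌋) ∧ not (⌊ y <? x ⌋)

-- The straight-line chords ab and cd cross (in their interiors) iff the
-- four endpoints are distinct and c,d separate a,b on the circle, i.e.
-- exactly one of c,d lies strictly between a and b.
crossesᵇ : {n : ℕ} → ConvexDrawing n → Fin n → Fin n → Fin n → Fin n → Bool
crossesᵇ D a b c d =
  not (eqᵇ (pos D a) (pos D c)) ∧ not (eqᵇ (pos D a) (pos D d)) ∧
  not (eqᵇ (pos D b) (pos D c)) ∧ not (eqᵇ (pos D b) (pos D d)) ∧
  (strictlyBetween (pos D a) (pos D b) (pos D c)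
     xor strictlyBetween (pos D a) (pos D b) (pos D d))

allPairs : (n : ℕ) → List (Fin n × Fin n)
allPairs n = concatMap (λ c → map (λ d → (c , d)) (allFin n)) (allFin n)

-- number of edges of G crossing the chord ab in drawing D
-- (each edge {c,d} counted once, via c < d)
crossCount : {n : ℕ} → Graph n → ConvexDrawing n → Fin n → Fin n → ℕ
crossCount {n} G D a b =
  length (filterᵇ (λ { (c , d) → ⌊ c <? d ⌋ ∧ adj G c d ∧ crossesᵇ D a b c d })
                  (allPairs n))

IsOuterMinKPlanarDrawing : {n : ℕ} → ℕ → Graph n → ConvexDrawing n → Set
IsOuterMinKPlanarDrawing k G D =
  ∀ a b c d → adj G a b ≡ true → adj G c d ≡ true →
  crossesᵇ D a b c d ≡ true →
  crossCount G D a b ≤ k ⊎ crossCount G D c d ≤ k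

OuterMinKPlanar : {n : ℕ} → ℕ → Graph n → Set
OuterMinKPlanar {n} k G = Σ (ConvexDrawing n) (IsOuterMinKPlanarDrawing k G)

data WalkIn {n : ℕ} (G : Graph n) (P : Fin n → Set) : Fin n → Fin n → Set where
  here : ∀ {u} → P u → WalkIn G P u u
  step : ∀ {u w v} → P u → adj G u w ≡ true → WalkIn G P w v → WalkIn G P u v

Connected : {n : ℕ} → Graph n → Set
Connected G = ∀ s t → WalkIn G (λ _ → ⊤) s t

Acyclic : {n : ℕ} → Graph n → Set
Acyclic {n} G =
  ∀ (l : ℕ) (c : Fin (3 + l) → Fin n) → Injective _≡_ _≡_ c →
  (∀ (i : Fin (2 + l)) → adj G (c (inject₁ i)) (c (suc i)) ≡ true) →
  adj G (c (fromℕ (2 + l))) (c zero) ≡ true → ⊥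

IsTree : {m : ℕ} → Graph m → Set
IsTree T = Connected T × Acyclic T

record TreeDecomposition {n : ℕ} (G : Graph n) (w : ℕ) : Set where
  field
    m            : ℕ
    tree         : Graph (suc m)
    isTree       : IsTree tree
    bag          : Fin (suc m) → Fin n → Bool
    cover-vertex : ∀ v → ∃ λ t → bag t v ≡ true
    cover-edge   : ∀ u v → adj G u v ≡ true →
                   ∃ λ t → (bag t u ≡ true) × (bag t v ≡ true)
    subtree      : ∀ v s t → bag s v ≡ true → bag t v ≡ true →
                   WalkIn tree (λ x → bag x v ≡ true) s t
    width        : ∀ t → countᵇ (bag t) ≤ suc w

TreewidthAtMost : {n : ℕ} → ℕ → Graph n → Set
TreewidthAtMost w G = TreeDecomposition G w

{-# OPTIONS --safe #-}
-- Call an edge light if at most k = K + 1 edges cross it; of two crossing edges one is light.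
--
-- Every chord pq crossed by at most 2K + 1 edges can be completed to a triangle pwq whose sides pw and
-- wq are again crossed by at most 2K + 1 edges.  Choose s between p and q so that at most K of the
-- edges crossing pq end strictly between p and s, and at most K strictly between s and q.  If no edge
-- under pq passes over s, then w = s will do.  Otherwise let ab be an outermost such edge.  If it is
-- light, one of its ends will do.  If it is heavy, all edges crossing it are light, and w is an end
-- of one of them: of one that also crosses pq and whose end between p and q is nearest to s, or, if
-- there is none, of a longest one.  In each case an edge crossing pw either crosses the light edge or
-- is among the K edges crossing pq on that side of s, and likewise for wq.
--
-- Recursion on these triangles yields a tree decomposition.  The bag of a triangle consists of its
-- corners and one end of each edge crossing two of its sides, hence has at most 3 + (3K + 1) elements.
-- Between the bag that a triangle is attached to and its own bag comes one that adds the apex w to a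
-- guard of pq, namely p, q and one end of each edge crossing pq.
module Submission where

open import Defs
open import Data.Bool using (Bool; true; false; _∧_; _∨_; _xor_; not; T; T?; if_then_else_)
open import Data.Bool.ListAction using (any)
open import Data.Bool.Properties using (T-∧; T-≡)
open import Data.Empty using (⊥-elim)
open import Data.Fin as Fin using (Fin; zero; suc; toℕ; inject₁; fromℕ)
import Data.Fin.Properties as Fin
open import Data.Fin.Relation.Unary.Top using (view; ‵fromℕ; ‵inject₁)
open import Data.List using (List; []; _∷_; _++_; map; concatMap; filter; filterᵇ; length; allFin)
open import Data.List.Membership.Propositional using (_∈_)
open import Data.List.Membership.Propositional.Properties
  using (∈-map⁺; ∈-map⁻; ∈-filter⁺; ∈-filter⁻; ∈-concatMap⁺; ∈-allFin)
open import Data.List.Properties using (filter-accept; filter-reject; length-map)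
open import Data.List.Relation.Unary.All as All using (All; []; _∷_)
open import Data.List.Relation.Unary.All.Properties using (++⁺)
open import Data.List.Relation.Unary.AllPairs using ([]; _∷_)
open import Data.List.Relation.Unary.Any as Any using () renaming (here to head; there to tail)
open import Data.List.Relation.Unary.Unique.Propositional using (Unique)
open import Data.List.Relation.Unary.Unique.Propositional.Properties using (allFin⁺)
open import Data.Nat
open import Data.Nat.Properties
open import Data.List.Membership.DecPropositional _≟_ using (_∈?_)
open import Data.Nat.Solver using (module +-*-Solver)
open import Data.Product using (_×_; _,_; proj₁; proj₂; ∃)
open import Data.Sum as Sum using (_⊎_; inj₁; inj₂)
open import Data.Unit using (tt)
open import Function using (id; _∘_; Equivalence)
open import Function.Definitions using (Injective)
open import Level using (0ℓ)
import Relation.Binary as Binary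
open import Relation.Binary using (Rel; Transitive; tri<; tri≈; tri>)
open import Relation.Binary.PropositionalEquality
  using (_≡_; _≢_; refl; cong; trans; subst; subst₂) renaming (sym to ≡-sym)
open import Relation.Nullary using (¬_; Dec; yes; no; contradiction; Reflects; ofʸ; ofⁿ)
open import Relation.Nullary.Decidable
  using (⌊_⌋; _×-dec_; _⊎-dec_; _→-dec_; ¬?; decidable-stable; toWitness; fromWitness)
open import Relation.Nullary.Reflects using (_×-reflects_; _⊎-reflects_; _→-reflects_; ¬-reflects)
open import Relation.Unary using (Pred; Decidable)

-- Deciding statements about the order of natural numbers

infix  8 _≺_ _≼_ _≈_
infix  7 ~_
infixr 6 _⊓ᶠ_
infixr 5 _⊔ᶠ_ _⊕_
infixr 4 _⇒_

data Form : Set where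
  _≺_ _≼_ _≈_           : ℕ → ℕ → Form
  _⊓ᶠ_ _⊔ᶠ_ _⇒_ _⊕_     : Form → Form → Form
  ~_                    : Form → Form

module Semantics (ρ : ℕ → ℕ) where

  ⟦_⟧ : Form → Set
  ⟦ i ≺ j ⟧  = ρ i < ρ j
  ⟦ i ≼ j ⟧  = ρ i ≤ ρ j
  ⟦ i ≈ j ⟧  = ρ i ≡ ρ j
  ⟦ φ ⊓ᶠ ψ ⟧ = ⟦ φ ⟧ × ⟦ ψ ⟧
  ⟦ φ ⊔ᶠ ψ ⟧ = ⟦ φ ⟧ ⊎ ⟦ ψ ⟧
  ⟦ φ ⇒ ψ ⟧  = ⟦ φ ⟧ → ⟦ ψ ⟧
  ⟦ φ ⊕ ψ ⟧  = (⟦ φ ⟧ × ¬ ⟦ ψ ⟧) ⊎ (¬ ⟦ φ ⟧ × ⟦ ψ ⟧)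
  ⟦ ~ φ ⟧    = ¬ ⟦ φ ⟧

  dec : ∀ φ → Dec ⟦ φ ⟧
  dec (i ≺ j)  = ρ i <? ρ j
  dec (i ≼ j)  = ρ i ≤? ρ j
  dec (i ≈ j)  = ρ i ≟ ρ j
  dec (φ ⊓ᶠ ψ) = dec φ ×-dec dec ψ
  dec (φ ⊔ᶠ ψ) = dec φ ⊎-dec dec ψ
  dec (φ ⇒ ψ)  = dec φ →-dec dec ψ
  dec (φ ⊕ ψ)  = (dec φ ×-dec ¬? (dec ψ)) ⊎-dec (¬? (dec φ) ×-dec dec ψ)
  dec (~ φ)    = ¬? (dec φ)

-- A fact `(i , s , j)` stands for `i < j` if `s` is `true` and for `i ≤ j` otherwise. The sign
-- `false` marks a negated formula.
Signed Fact : Set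
Signed = Bool × Form
Fact   = ℕ × Bool × ℕ

data Step : Set where
  facts : List Fact → Step
  all   : List Signed → Step
  split : List Signed → List Signed → Step

expand : Signed → Step
expand (true  , i ≺ j)  = facts ((i , true , j) ∷ [])
expand (false , i ≺ j)  = facts ((j , false , i) ∷ [])
expand (true  , i ≼ j)  = facts ((i , false , j) ∷ [])
expand (false , i ≼ j)  = facts ((j , true , i) ∷ [])
expand (true  , i ≈ j)  = facts ((i , false , j) ∷ (j , false , i) ∷ [])
expand (false , i ≈ j)  = split ((true , i ≺ j) ∷ []) ((true , j ≺ i) ∷ [])
expand (true  , φ ⊓ᶠ ψ) = all ((true , φ) ∷ (true , ψ) ∷ [])
expand (false , φ ⊓ᶠ ψ) = split ((false , φ) ∷ []) ((false , ψ) ∷ [])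
expand (true  , φ ⊔ᶠ ψ) = split ((true , φ) ∷ []) ((true , ψ) ∷ [])
expand (false , φ ⊔ᶠ ψ) = all ((false , φ) ∷ (false , ψ) ∷ [])
expand (true  , φ ⇒ ψ)  = split ((false , φ) ∷ []) ((true , ψ) ∷ [])
expand (false , φ ⇒ ψ)  = all ((true , φ) ∷ (false , ψ) ∷ [])
expand (true  , φ ⊕ ψ)  = split ((true , φ) ∷ (false , ψ) ∷ []) ((false , φ) ∷ (true , ψ) ∷ [])
expand (false , φ ⊕ ψ)  = split ((true , φ) ∷ (true , ψ) ∷ []) ((false , φ) ∷ (false , ψ) ∷ [])
expand (s     , ~ φ)    = all ((not s , φ) ∷ [])

implied : Fact → List Fact → Bool
implied f [] = false
implied f@(i , s , j) ((a , t , b) ∷ H) = ((i ≡ᵇ a) ∧ (j ≡ᵇ b) ∧ (t ∨ not s)) ∨ implied f H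

into from : Fact → List Fact → List Fact
into f [] = []
into f@(i , s , j) ((a , t , b) ∷ H) = if b ≡ᵇ i then (a , (t ∨ s) , j) ∷ into f H else into f H
from f [] = []
from f@(i , s , j) ((a , t , b) ∷ H) = if j ≡ᵇ a then (i , (s ∨ t) , b) ∷ from f H else from f H

insert : List Fact → List Fact → List Fact
insert [] H = H
insert (f ∷ F) H = if implied f H then insert F H else insert F (f ∷ H)

-- Maintains transitive closure, so that contra and absurdᵇ need only look for single facts.
extend : Fact → List Fact → List Fact
extend f H = if implied f H then H
             else insert (concatMap (λ g → g ∷ from g H) (f ∷ into f H)) H

absurdᵇ : List Fact → Bool
absurdᵇ [] = false
absurdᵇ ((i , s , j) ∷ H) = (s ∧ (i ≡ᵇ j)) ∨ absurdᵇ H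

extends : List Fact → List Fact → List Fact
extends []      H = H
extends (f ∷ F) H = extends F (extend f H)

-- This test only guides the search: it selects formulas to drop and the case distinction to make
-- first, and refutations stay sound whatever it answers.
contra : List Fact → Signed → Bool
contra H (true  , i ≺ j)  = implied (j , false , i) H
contra H (false , i ≺ j)  = implied (i , true , j) H
contra H (true  , i ≼ j)  = implied (j , true , i) H
contra H (false , i ≼ j)  = implied (i , false , j) H
contra H (true  , i ≈ j)  = implied (i , true , j) H ∨ implied (j , true , i) H
contra H (false , i ≈ j)  = implied (i , false , j) H ∧ implied (j , false , i) H
contra H (true  , φ ⊓ᶠ ψ) = contra H (true , φ) ∨ contra H (true , ψ)
contra H (false , φ ⊓ᶠ ψ) = contra H (false , φ) ∧ contra H (false , ψ)
contra H (true  , φ ⊔ᶠ ψ) = contra H (true , φ) ∧ contra H (true , ψ)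
contra H (false , φ ⊔ᶠ ψ) = contra H (false , φ) ∨ contra H (false , ψ)
contra H (true  , φ ⇒ ψ)  = contra H (false , φ) ∧ contra H (true , ψ)
contra H (false , φ ⇒ ψ)  = contra H (true , φ) ∨ contra H (false , ψ)
contra H (true  , φ ⊕ ψ)  = (contra H (true , φ) ∨ contra H (false , ψ))
                          ∧ (contra H (false , φ) ∨ contra H (true , ψ))
contra H (false , φ ⊕ ψ)  = (contra H (true , φ) ∨ contra H (true , ψ))
                          ∧ (contra H (false , φ) ∨ contra H (false , ψ))
contra H (true  , ~ φ)    = contra H (false , φ)
contra H (false , ~ φ)    = contra H (true , φ)

-- Case distinctions with an immediately refutable case are made first.
unitary : List Fact → Signed → Bool
unitary H d with expand d
... | facts F   = true
... | all A     = true
... | split A B = any (contra H) A ∨ any (contra H) B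

simplify : List Fact → List Signed → List Signed
simplify H [] = []
simplify H ((s , φ) ∷ D) = if contra H (not s , φ) then simplify H D else (s , φ) ∷ simplify H D

front : List Fact → List Signed → List Signed
front H []      = []
front H (d ∷ D) = if unitary H d then d ∷ D else raise (front H D)
  where
  raise : List Signed → List Signed
  raise []       = d ∷ []
  raise (e ∷ D′) = if unitary H e then e ∷ d ∷ D′ else d ∷ e ∷ D′

-- A tableau prover: refute n S D H looks for a contradiction between the formulas S and D and the
-- facts H, postponing case distinctions to D; n bounds the depth of the search.
refute : ℕ → List Signed → List Signed → List Fact → Bool
refute zero    _ _ _ = false
refute (suc n) [] D₀ H with front H (simplify H D₀)
... | [] = false
... | d ∷ D with expand d
...   | facts F   = refute n [] D (extends F H)
...   | all A     = refute n A D H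
...   | split A B = refute n A D H ∧ refute n B D H
refute (suc n) (s ∷ S) D H with expand s
... | facts F   = let H′ = extends F H in absurdᵇ H′ ∨ refute n S D H′
... | all A     = refute n (A ++ S) D H
... | split A B = refute n S (D ++ (s ∷ [])) H

-- Soundness of the tableau prover

module Soundness (ρ : ℕ → ℕ) where
  open Semantics ρ

  ⟦_⟧ˢ : Signed → Set
  ⟦ true  , φ ⟧ˢ = ⟦ φ ⟧
  ⟦ false , φ ⟧ˢ = ¬ ⟦ φ ⟧

  ⟦_⟧ᶠ : Fact → Set
  ⟦ i , true  , j ⟧ᶠ = ρ i < ρ j
  ⟦ i , false , j ⟧ᶠ = ρ i ≤ ρ j

  ⟦_⟧ˣ : Step → Set
  ⟦ facts F ⟧ˣ   = All ⟦_⟧ᶠ F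
  ⟦ all A ⟧ˣ     = All ⟦_⟧ˢ A
  ⟦ split A B ⟧ˣ = All ⟦_⟧ˢ A ⊎ All ⟦_⟧ˢ B

  -- Classical case distinctions are justified here because `dec` decides every formula.
  expand-sound : ∀ s → ⟦ s ⟧ˢ → ⟦ expand s ⟧ˣ
  expand-sound (true  , i ≺ j) h = h ∷ []
  expand-sound (false , i ≺ j) h = ≮⇒≥ h ∷ []
  expand-sound (true  , i ≼ j) h = h ∷ []
  expand-sound (false , i ≼ j) h = ≰⇒> h ∷ []
  expand-sound (true  , i ≈ j) h = ≤-reflexive h ∷ ≤-reflexive (≡-sym h) ∷ []
  expand-sound (false , i ≈ j) h with ρ i <? ρ j
  ... | yes l = inj₁ (l ∷ [])
  ... | no ¬l = inj₂ (≤∧≢⇒< (≮⇒≥ ¬l) (h ∘ ≡-sym) ∷ [])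
  expand-sound (true  , φ ⊓ᶠ ψ) (h , k) = h ∷ k ∷ []
  expand-sound (false , φ ⊓ᶠ ψ) h with dec φ
  ... | yes p = inj₂ ((λ q → h (p , q)) ∷ [])
  ... | no ¬p = inj₁ (¬p ∷ [])
  expand-sound (true  , φ ⊔ᶠ ψ) (inj₁ h) = inj₁ (h ∷ [])
  expand-sound (true  , φ ⊔ᶠ ψ) (inj₂ h) = inj₂ (h ∷ [])
  expand-sound (false , φ ⊔ᶠ ψ) h = h ∘ inj₁ ∷ h ∘ inj₂ ∷ []
  expand-sound (true  , φ ⇒ ψ) h with dec φ
  ... | yes p = inj₂ (h p ∷ [])
  ... | no ¬p = inj₁ (¬p ∷ [])
  expand-sound (false , φ ⇒ ψ) h =
    decidable-stable (dec φ) (λ ¬p → h (λ p → contradiction p ¬p)) ∷ (λ q → h (λ _ → q)) ∷ []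
  expand-sound (true  , φ ⊕ ψ) (inj₁ (p , q)) = inj₁ (p ∷ q ∷ [])
  expand-sound (true  , φ ⊕ ψ) (inj₂ (p , q)) = inj₂ (p ∷ q ∷ [])
  expand-sound (false , φ ⊕ ψ) h with dec φ | dec ψ
  ... | yes p | yes q = inj₁ (p ∷ q ∷ [])
  ... | yes p | no ¬q = contradiction (inj₁ (p , ¬q)) h
  ... | no ¬p | yes q = contradiction (inj₂ (¬p , q)) h
  ... | no ¬p | no ¬q = inj₂ (¬p ∷ ¬q ∷ [])
  expand-sound (true  , ~ φ) h = h ∷ []
  expand-sound (false , ~ φ) h = decidable-stable (dec φ) h ∷ []

  trans-sound : ∀ i s j t k → ⟦ i , s , j ⟧ᶠ → ⟦ j , t , k ⟧ᶠ → ⟦ i , s ∨ t , k ⟧ᶠ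
  trans-sound i true  j true  k = <-trans
  trans-sound i true  j false k = <-≤-trans
  trans-sound i false j true  k = ≤-<-trans
  trans-sound i false j false k = ≤-trans

  into-sound : ∀ f H → ⟦ f ⟧ᶠ → All ⟦_⟧ᶠ H → All ⟦_⟧ᶠ (into f H)
  into-sound f [] h [] = []
  into-sound f@(i , s , j) ((a , t , b) ∷ H) h (k ∷ ks) with b ≡ᵇ i in eq
  ... | false = into-sound f H h ks
  ... | true with refl ← ≡ᵇ⇒≡ b i (subst T (≡-sym eq) tt) =
    trans-sound a t b s j k h ∷ into-sound f H h ks

  from-sound : ∀ f H → ⟦ f ⟧ᶠ → All ⟦_⟧ᶠ H → All ⟦_⟧ᶠ (from f H)
  from-sound f [] h [] = []
  from-sound f@(i , s , j) ((a , t , b) ∷ H) h (k ∷ ks) with j ≡ᵇ a in eq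
  ... | false = from-sound f H h ks
  ... | true with refl ← ≡ᵇ⇒≡ j a (subst T (≡-sym eq) tt) =
    trans-sound i s j t b h k ∷ from-sound f H h ks

  insert-sound : ∀ F H → All ⟦_⟧ᶠ F → All ⟦_⟧ᶠ H → All ⟦_⟧ᶠ (insert F H)
  insert-sound [] H [] hs = hs
  insert-sound (f ∷ F) H (k ∷ ks) hs with implied f H
  ... | true  = insert-sound F H ks hs
  ... | false = insert-sound F (f ∷ H) ks (k ∷ hs)

  compose-sound : ∀ F H → All ⟦_⟧ᶠ F → All ⟦_⟧ᶠ H →
                  All ⟦_⟧ᶠ (concatMap (λ g → g ∷ from g H) F)
  compose-sound [] H [] hs = []
  compose-sound (f ∷ F) H (k ∷ ks) hs =
    k ∷ ++⁺ (from-sound f H k hs) (compose-sound F H ks hs)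

  extend-sound : ∀ f H → ⟦ f ⟧ᶠ → All ⟦_⟧ᶠ H → All ⟦_⟧ᶠ (extend f H)
  extend-sound f H h hs = if-elim (implied f H) hs
    (insert-sound _ H (compose-sound (f ∷ into f H) H (h ∷ into-sound f H h hs) hs) hs)
    where
    if-elim : ∀ b {F G} → All ⟦_⟧ᶠ F → All ⟦_⟧ᶠ G → All ⟦_⟧ᶠ (if b then F else G)
    if-elim true  p q = p
    if-elim false p q = q

  extends-sound : ∀ F H → All ⟦_⟧ᶠ F → All ⟦_⟧ᶠ H → All ⟦_⟧ᶠ (extends F H)
  extends-sound [] H [] hs = hs
  extends-sound (f ∷ F) H (k ∷ ks) hs = extends-sound F _ ks (extend-sound f H k hs)

  absurd-sound : ∀ H → T (absurdᵇ H) → ¬ All ⟦_⟧ᶠ H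
  absurd-sound ((i , false , j) ∷ H) e (h ∷ hs) = absurd-sound H e hs
  absurd-sound ((i , true  , j) ∷ H) e (h ∷ hs) with i ≡ᵇ j in eq
  ... | false = absurd-sound H e hs
  ... | true  = <⇒≢ h (cong ρ (≡ᵇ⇒≡ i j (subst T (≡-sym eq) tt)))

  simplify-sound : ∀ H D → All ⟦_⟧ˢ D → All ⟦_⟧ˢ (simplify H D)
  simplify-sound H [] [] = []
  simplify-sound H ((s , φ) ∷ D) (k ∷ ks) with contra H (not s , φ)
  ... | true  = simplify-sound H D ks
  ... | false = k ∷ simplify-sound H D ks

  front-sound : ∀ H D → All ⟦_⟧ˢ D → All ⟦_⟧ˢ (front H D)
  front-sound H [] [] = []
  front-sound H (d ∷ D) (k ∷ ks) with unitary H d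
  ... | true = k ∷ ks
  ... | false with front H D | front-sound H D ks
  ...   | [] | [] = k ∷ []
  ...   | e ∷ D′ | j ∷ js with unitary H e
  ...     | true  = j ∷ k ∷ js
  ...     | false = k ∷ j ∷ js

  refute-sound : ∀ n S D H → T (refute n S D H) →
                 All ⟦_⟧ˢ S → All ⟦_⟧ˢ D → ¬ All ⟦_⟧ᶠ H
  refute-sound (suc n) [] D₀ H e [] ks₀ hs
    with front H (simplify H D₀) | front-sound H _ (simplify-sound H D₀ ks₀)
  ... | d ∷ D | k ∷ ks with expand d | expand-sound d k
  ...   | facts F   | m = refute-sound n [] D (extends F H) e [] ks (extends-sound F H m hs)
  ...   | all A     | m = refute-sound n A D H e m ks hs
  ...   | split A B | inj₁ m = refute-sound n A D H (proj₁ (Equivalence.to T-∧ e)) m ks hs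
  ...   | split A B | inj₂ m = refute-sound n B D H (proj₂ (Equivalence.to (T-∧ {refute n A D H}) e)) m ks hs
  refute-sound (suc n) (s ∷ S) D H e (j ∷ js) ks hs with expand s | expand-sound s j
  ... | facts F   | m with absurdᵇ (extends F H) in eq
  ...   | true  = absurd-sound (extends F H) (subst T (≡-sym eq) tt) (extends-sound F H m hs)
  ...   | false = refute-sound n S D (extends F H) e js ks (extends-sound F H m hs)
  refute-sound (suc n) (s ∷ S) D H e (j ∷ js) ks hs | all A     | m =
    refute-sound n (A ++ S) D H e (++⁺ m js) ks hs
  refute-sound (suc n) (s ∷ S) D H e (j ∷ js) ks hs | split A B | m =
    refute-sound n S (D ++ (s ∷ [])) H e js (++⁺ ks (j ∷ [])) hs

env : List ℕ → ℕ → ℕ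
env []       _       = 0
env (x ∷ xs) zero    = x
env (x ∷ xs) (suc i) = env xs i

-- The semantics of a concrete formula computes to the relation it spells out, so `decide` and
-- `order` serve directly for relations such as `Cross`.
decide : ∀ φ xs → Dec (Semantics.⟦_⟧ (env xs) φ)
decide φ xs = Semantics.dec (env xs) φ

-- The variable i of a formula denotes the i-th entry of the list.  Being abstract keeps the large
-- proof terms from being unfolded.
abstract
  order : ∀ φ → {T (refute 100 ((false , φ) ∷ []) [] [])} → ∀ xs → Semantics.⟦_⟧ (env xs) φ
  order φ {e} xs = decidable-stable (Semantics.dec (env xs) φ)
    (λ ¬p → Soundness.refute-sound (env xs) 100 ((false , φ) ∷ []) [] [] e (¬p ∷ []) [] [])

-- Counting

count : ∀ {A : Set} {P : Pred A 0ℓ} → Decidable P → List A → ℕ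
count P? xs = length (filter P? xs)

module _ {A : Set} {P : Pred A 0ℓ} (P? : Decidable P) where

  count-yes : ∀ {x xs} → P x → count P? (x ∷ xs) ≡ suc (count P? xs)
  count-yes p = cong length (filter-accept P? p)

  count-no : ∀ {x xs} → ¬ P x → count P? (x ∷ xs) ≡ count P? xs
  count-no ¬p = cong length (filter-reject P? ¬p)

  count-∷ : ∀ x xs → count P? xs ≤ count P? (x ∷ xs)
  count-∷ x xs with P? x
  ... | yes _ = n≤1+n _
  ... | no  _ = ≤-refl

  count-none : ∀ xs → (∀ {x} → x ∈ xs → ¬ P x) → count P? xs ≡ 0
  count-none []       h = refl
  count-none (x ∷ xs) h = trans (count-no (h (head refl))) (count-none xs (h ∘ tail))

  count-some : ∀ xs → 0 < count P? xs → ∃ λ x → x ∈ xs × P x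
  count-some (x ∷ xs) h with P? x
  ... | yes p = x , head refl , p
  ... | no _ with count-some xs h
  ...   | y , y∈ , p = y , tail y∈ , p

module _ {A : Set} {P Q : Pred A 0ℓ} (P? : Decidable P) (Q? : Decidable Q) where

  count-⊆ : ∀ xs → (∀ {x} → x ∈ xs → P x → Q x) → count P? xs ≤ count Q? xs
  count-⊆ []       h = z≤n
  count-⊆ (x ∷ xs) h with P? x
  ... | no  _ = ≤-trans (count-⊆ xs (h ∘ tail)) (count-∷ Q? x xs)
  ... | yes p rewrite count-yes Q? {xs = xs} (h (head refl) p) = s≤s (count-⊆ xs (h ∘ tail))

module _ {A : Set} {P Q R : Pred A 0ℓ} (P? : Decidable P) (Q? : Decidable Q) (R? : Decidable R) where

  count-⊎ : ∀ xs → (∀ {x} → x ∈ xs → P x → Q x ⊎ R x) →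
            count P? xs ≤ count Q? xs + count R? xs
  count-⊎ []       h = z≤n
  count-⊎ (x ∷ xs) h with P? x
  ... | no _ = ≤-trans (count-⊎ xs (h ∘ tail)) (+-mono-≤ (count-∷ Q? x xs) (count-∷ R? x xs))
  ... | yes p with h (head refl) p
  ...   | inj₁ q rewrite count-yes Q? {xs = xs} q =
    s≤s (≤-trans (count-⊎ xs (h ∘ tail)) (+-monoʳ-≤ _ (count-∷ R? x xs)))
  ...   | inj₂ r rewrite count-yes R? {xs = xs} r | +-suc (count Q? (x ∷ xs)) (count R? xs) =
    s≤s (≤-trans (count-⊎ xs (h ∘ tail)) (+-monoˡ-≤ _ (count-∷ Q? x xs)))

  count-disjoint : ∀ xs → (∀ {x} → x ∈ xs → P x → R x) → (∀ {x} → x ∈ xs → Q x → R x) →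
                   (∀ {x} → x ∈ xs → P x → ¬ Q x) →
                   count P? xs + count Q? xs ≤ count R? xs
  count-disjoint []       _ _ _ = z≤n
  count-disjoint (x ∷ xs) f g h with P? x
  ... | yes p rewrite count-no Q? {xs = xs} (h (head refl) p) | count-yes R? {xs = xs} (f (head refl) p) =
    s≤s (count-disjoint xs (f ∘ tail) (g ∘ tail) (h ∘ tail))
  ... | no _ with Q? x
  ...   | no  _ = ≤-trans (count-disjoint xs (f ∘ tail) (g ∘ tail) (h ∘ tail)) (count-∷ R? x xs)
  ...   | yes q rewrite count-yes R? {xs = xs} (g (head refl) q) | +-suc (count P? xs) (count Q? xs) =
    s≤s (count-disjoint xs (f ∘ tail) (g ∘ tail) (h ∘ tail))

  -- Double counting: every element of `S` contributes at least two to the right-hand side.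
  count-twice : ∀ {S : Pred A 0ℓ} (S? : Decidable S) → ∀ xs →
                (∀ {x} → x ∈ xs → S x → (P x × Q x) ⊎ (P x × R x) ⊎ (Q x × R x)) →
                count S? xs + count S? xs ≤ count P? xs + (count Q? xs + count R? xs)
  count-twice S? []       h = z≤n
  count-twice S? (x ∷ xs) h with S? x
  ... | no _ = ≤-trans (count-twice S? xs (h ∘ tail))
                 (+-mono-≤ (count-∷ P? x xs) (+-mono-≤ (count-∷ Q? x xs) (count-∷ R? x xs)))
  ... | yes t rewrite +-suc (count S? xs) (count S? xs) with h (head refl) t
  ...   | inj₁ (p , q) rewrite count-yes P? {xs = xs} p | count-yes Q? {xs = xs} q
            | +-suc (count P? xs) (count Q? xs + count R? (x ∷ xs)) =
    s≤s (s≤s (≤-trans (count-twice S? xs (h ∘ tail)) (+-monoʳ-≤ (count P? xs) (+-monoʳ-≤ (count Q? xs) (count-∷ R? x xs)))))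
  ...   | inj₂ (inj₁ (p , r)) rewrite count-yes P? {xs = xs} p | count-yes R? {xs = xs} r
            | +-suc (count Q? (x ∷ xs)) (count R? xs)
            | +-suc (count P? xs) (count Q? (x ∷ xs) + count R? xs) =
    s≤s (s≤s (≤-trans (count-twice S? xs (h ∘ tail)) (+-monoʳ-≤ (count P? xs) (+-monoˡ-≤ (count R? xs) (count-∷ Q? x xs)))))
  ...   | inj₂ (inj₂ (q , r)) rewrite count-yes Q? {xs = xs} q | count-yes R? {xs = xs} r
            | +-suc (count Q? xs) (count R? xs)
            | +-suc (count P? (x ∷ xs)) (suc (count Q? xs + count R? xs))
            | +-suc (count P? (x ∷ xs)) (count Q? xs + count R? xs) =
    s≤s (s≤s (≤-trans (count-twice S? xs (h ∘ tail)) (+-monoˡ-≤ (count Q? xs + count R? xs) (count-∷ P? x xs))))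

module _ {A : Set} {P : Pred A 0ℓ} (P? : Decidable P) {_⊏_ : Rel A 0ℓ} (_⊏?_ : Binary.Decidable _⊏_)
         (⊏-trans : Transitive _⊏_) (⊏-irrefl : ∀ {x} → ¬ x ⊏ x) where

  -- The order may be partial, so the element found is only minimal. A head below the minimum `m` of
  -- the tail replaces it: by transitivity, anything below the head would be below `m`.
  least : ∀ xs → (∀ {x} → x ∈ xs → ¬ P x) ⊎
          ∃ λ m → m ∈ xs × P m × (∀ {x} → x ∈ xs → P x → ¬ x ⊏ m)
  least [] = inj₁ λ ()
  least (x ∷ xs) with P? x | least xs
  ... | no ¬p | inj₁ none = inj₁ λ { (head refl) → ¬p ; (tail x∈) → none x∈ }
  ... | no ¬p | inj₂ (m , m∈ , p , min) =
    inj₂ (m , tail m∈ , p , λ { (head refl) p′ → contradiction p′ ¬p ; (tail x∈) → min x∈ })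
  ... | yes p | inj₁ none =
    inj₂ (x , head refl , p , λ { (head refl) _ → ⊏-irrefl ; (tail x∈) p′ → contradiction p′ (none x∈) })
  ... | yes p | inj₂ (m , m∈ , q , min) with x ⊏? m
  ...   | yes x⊏m = inj₂ (x , head refl , p ,
    λ { (head refl) _ → ⊏-irrefl ; (tail y∈) p′ y⊏x → min y∈ p′ (⊏-trans y⊏x x⊏m) })
  ...   | no  x⊀m = inj₂ (m , tail m∈ , q , λ { (head refl) _ → x⊀m ; (tail y∈) → min y∈ })

-- Splitting a chord

Edge : Set
Edge = ℕ × ℕ

-- Lower-case names of relations stand for the formulas denoting them.
cross : ℕ → ℕ → ℕ → ℕ → Form
cross p q x y = (p ≺ x ⊓ᶠ x ≺ q ⊓ᶠ q ≺ y) ⊔ᶠ (x ≺ p ⊓ᶠ p ≺ y ⊓ᶠ y ≺ q)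

Cross : ℕ → ℕ → Edge → Set
Cross p q (x , y) = (p < x × x < q × q < y) ⊎ (x < p × p < y × y < q)

Cross? : ∀ p q e → Dec (Cross p q e)
Cross? p q (x , y) = decide (cross 0 1 2 3) (p ∷ q ∷ x ∷ y ∷ [])

crossings : List Edge → ℕ → ℕ → ℕ
crossings es p q = count (Cross? p q) es

before after : ℕ → ℕ → ℕ → ℕ → ℕ → Form
before p q s x y = (p ≺ x ⊓ᶠ x ≺ s ⊓ᶠ q ≺ y) ⊔ᶠ (x ≺ p ⊓ᶠ p ≺ y ⊓ᶠ y ≺ s)
after  p q s x y = (s ≺ x ⊓ᶠ x ≺ q ⊓ᶠ q ≺ y) ⊔ᶠ (x ≺ p ⊓ᶠ s ≺ y ⊓ᶠ y ≺ q)

Before After : ℕ → ℕ → ℕ → Edge → Set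
Before p q s (x , y) = (p < x × x < s × q < y) ⊎ (x < p × p < y × y < s)
After  p q s (x , y) = (s < x × x < q × q < y) ⊎ (x < p × s < y × y < q)

Before? : ∀ p q s e → Dec (Before p q s e)
Before? p q s (x , y) = decide (before 0 1 2 3 4) (p ∷ q ∷ s ∷ x ∷ y ∷ [])

After? : ∀ p q s e → Dec (After p q s e)
After? p q s (x , y) = decide (after 0 1 2 3 4) (p ∷ q ∷ s ∷ x ∷ y ∷ [])

-- Excluding `pq` itself ensures that some end of a spanning edge lies strictly between `p` and `q`.
span : ℕ → ℕ → ℕ → ℕ → ℕ → Form
span p q s x y = p ≼ x ⊓ᶠ x ≺ s ⊓ᶠ s ≺ y ⊓ᶠ y ≼ q ⊓ᶠ ~ (x ≈ p ⊓ᶠ y ≈ q)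

Span : ℕ → ℕ → ℕ → Edge → Set
Span p q s (x , y) = p ≤ x × x < s × s < y × y ≤ q × ¬ (x ≡ p × y ≡ q)

Span? : ∀ p q s e → Dec (Span p q s e)
Span? p q s (x , y) = decide (span 0 1 2 3 4) (p ∷ q ∷ s ∷ x ∷ y ∷ [])

-- Proper inclusion of intervals, oriented so that minimal elements are the outermost edges.
around : ℕ → ℕ → ℕ → ℕ → Form
around x y a b = (x ≺ a ⊓ᶠ b ≼ y) ⊔ᶠ (x ≼ a ⊓ᶠ b ≺ y)

Around : Edge → Edge → Set
Around (x , y) (a , b) = (x < a × b ≤ y) ⊎ (x ≤ a × b < y)

Around? : ∀ e f → Dec (Around e f)
Around? (x , y) (a , b) = decide (around 0 1 2 3) (x ∷ y ∷ a ∷ b ∷ [])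

Around-trans : ∀ {e f g} → Around e f → Around f g → Around e g
Around-trans {x , y} {a , b} {c , d} =
  order (around 0 1 2 3 ⇒ around 2 3 4 5 ⇒ around 0 1 4 5) (x ∷ y ∷ a ∷ b ∷ c ∷ d ∷ [])

Around-irrefl : ∀ {e} → ¬ Around e e
Around-irrefl {x , y} = order (~ around 0 1 0 1) (x ∷ y ∷ [])

-- The edges that cross `ab` but stay within the closed interval from `p` to `q`, according to the
-- side on which they leave `ab`.
leftX rightX : ℕ → ℕ → ℕ → ℕ → ℕ → Form
leftX  p a b x y = p ≼ x ⊓ᶠ x ≺ a ⊓ᶠ a ≺ y ⊓ᶠ y ≺ b
rightX q a b x y = a ≺ x ⊓ᶠ x ≺ b ⊓ᶠ b ≺ y ⊓ᶠ y ≼ q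

LeftX RightX : ℕ → ℕ → ℕ → Edge → Set
LeftX  p a b (x , y) = p ≤ x × x < a × a < y × y < b
RightX q a b (x , y) = a < x × x < b × b < y × y ≤ q

LeftX? : ∀ p a b e → Dec (LeftX p a b e)
LeftX? p a b (x , y) = decide (leftX 0 1 2 3 4) (p ∷ a ∷ b ∷ x ∷ y ∷ [])

RightX? : ∀ p a b e → Dec (RightX p a b e)
RightX? p a b (x , y) = decide (rightX 0 1 2 3 4) (p ∷ a ∷ b ∷ x ∷ y ∷ [])

-- For an edge crossing a chord with lower end p, its end under the chord.
inner : ℕ → Edge → ℕ
inner p (x , y) with p <? x
... | yes _ = x
... | no  _ = y

isInner : ℕ → ℕ → ℕ → ℕ → Form
isInner p x y z = (p ≺ x ⊓ᶠ z ≈ x) ⊔ᶠ (x ≼ p ⊓ᶠ z ≈ y)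

inner-spec : ∀ p x y → (p < x × inner p (x , y) ≡ x) ⊎ (x ≤ p × inner p (x , y) ≡ y)
inner-spec p x y with p <? x
... | yes p<x = inj₁ (p<x , refl)
... | no  p≮x = inj₂ (≮⇒≥ p≮x , refl)

-- Points strictly on different sides of `s` are incomparable: `i` has to lie between `s` and `z`,
-- possibly at `s`.
nearer : ℕ → ℕ → ℕ → Form
nearer s i z = (z ≺ i ⊓ᶠ i ≼ s) ⊔ᶠ (s ≼ i ⊓ᶠ i ≺ z)

Nearer : ℕ → ℕ → ℕ → Set
Nearer s i z = (z < i × i ≤ s) ⊎ (s ≤ i × i < z)

Nearer? : ∀ s i z → Dec (Nearer s i z)
Nearer? s i z = decide (nearer 0 1 2) (s ∷ i ∷ z ∷ [])

Nearer-trans : ∀ s {i j k} → Nearer s i j → Nearer s j k → Nearer s i k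
Nearer-trans s {i} {j} {k} =
  order (nearer 0 1 2 ⇒ nearer 0 2 3 ⇒ nearer 0 1 3) (s ∷ i ∷ j ∷ k ∷ [])

Nearer-irrefl : ∀ s {i} → ¬ Nearer s i i
Nearer-irrefl s {i} = order (~ nearer 0 1 1) (s ∷ i ∷ [])

module Splitting
  (es : List Edge) (lo<hi : ∀ {x y} → (x , y) ∈ es → x < y) (K : ℕ)
  (minPlanar : ∀ {a b x y} → (a , b) ∈ es → (x , y) ∈ es → Cross a b (x , y) →
               crossings es a b ≤ suc K ⊎ crossings es x y ≤ suc K)
  (p q : ℕ)
  where

  private
    cnt : ℕ → ℕ → ℕ
    cnt = crossings es

  record Good : Set where
    constructor good
    field
      w           : ℕ
      p<w         : p < w
      w<q         : w < q
      left-light  : cnt p w ≤ suc K + K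
      right-light : cnt w q ≤ suc K + K

  record Balanced : Set where
    constructor balanced
    field
      s       : ℕ
      p<s     : p < s
      s<q     : s < q
      before≤ : count (Before? p q s) es ≤ K
      after≤  : count (After? p q s) es ≤ K

  -- Sweep `s` to the right from `p + 1`, keeping at most `K` edges before it. If more than `K` come
  -- after `s`, at most `K` come before `s + 1`, because these two sets are disjoint and consist of
  -- edges crossing `pq`, of which there are at most `2K + 1`. The sweep ends by `q - 1`, after
  -- which no edge comes.
  balanced-point : cnt p q ≤ suc K + K → suc p < q → Balanced
  balanced-point cross≤ p+1<q = sweep q (suc p) ≤-refl p+1<q (m≤n+m q (suc p))
    (≤-trans (≤-reflexive (count-none (Before? p q (suc p)) es λ {(x , y)} _ →
       -- The prover knows only linear orders. That nothing lies strictly between `p` and `suc p` is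
       -- passed as hypotheses, proved by `id` since `p < x` unfolds to `suc p ≤ x`.
       order ((0 ≺ 3 ⇒ 2 ≼ 3) ⇒ (0 ≺ 4 ⇒ 2 ≼ 4) ⇒ ~ before 0 1 2 3 4)
         (p ∷ q ∷ suc p ∷ x ∷ y ∷ []) id id)) z≤n)
    where
    sweep : ∀ d s → p < s → s < q → q ≤ s + d → count (Before? p q s) es ≤ K → Balanced
    sweep d s p<s s<q q≤s+d before≤ with count (After? p q s) es ≤? K
    ... | yes after≤ = balanced s p<s s<q before≤ after≤
    ... | no  after≰ with suc s <? q
    ...   | no s+1≮q = contradiction (≤-trans (≤-reflexive (count-none (After? p q s) es λ {(x , y)} _ →
              order ((2 ≺ 3 ⇒ 1 ≼ 3) ⇒ (2 ≺ 4 ⇒ 1 ≼ 4) ⇒ ~ after 0 1 2 3 4)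
                (p ∷ q ∷ s ∷ x ∷ y ∷ []) (≤-trans (≮⇒≥ s+1≮q)) (≤-trans (≮⇒≥ s+1≮q)))) z≤n) after≰
    sweep zero s p<s s<q q≤s+d before≤ | no after≰ | yes s+1<q =
      contradiction (≤-trans q≤s+d (≤-reflexive (+-identityʳ s))) (<⇒≱ s<q)
    sweep (suc d) s p<s s<q q≤s+d before≤ | no after≰ | yes s+1<q =
      sweep d (suc s) (m<n⇒m<1+n p<s) s+1<q (≤-trans q≤s+d (≤-reflexive (+-suc s d)))
        (+-cancelʳ-≤ (suc K) _ K (begin
          count (Before? p q (suc s)) es + suc K
            ≤⟨ +-monoʳ-≤ _ (≰⇒> after≰) ⟩
          count (Before? p q (suc s)) es + count (After? p q s) es
            ≤⟨ count-disjoint (Before? p q (suc s)) (After? p q s) (Cross? p q) es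
                 (λ {(x , y)} _ → order (2 ≺ 1 ⇒ before 0 1 2 3 4 ⇒ cross 0 1 3 4)
                    (p ∷ q ∷ suc s ∷ x ∷ y ∷ []) s+1<q)
                 (λ {(x , y)} _ → order (0 ≺ 2 ⇒ after 0 1 2 3 4 ⇒ cross 0 1 3 4)
                    (p ∷ q ∷ s ∷ x ∷ y ∷ []) p<s)
                 (λ {(x , y)} e∈ → order ((2 ≺ 3 ⇒ 5 ≼ 3) ⇒ (2 ≺ 4 ⇒ 5 ≼ 4) ⇒
                      2 ≺ 1 ⇒ 5 ≺ 1 ⇒ 0 ≺ 2 ⇒ before 0 1 5 3 4 ⇒ ~ after 0 1 2 3 4)
                    (p ∷ q ∷ s ∷ x ∷ y ∷ suc s ∷ []) id id s<q s+1<q p<s) ⟩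
          cnt p q    ≤⟨ cross≤ ⟩
          suc K + K  ≡⟨ +-comm (suc K) K ⟩
          K + suc K  ∎))
      where open ≤-Reasoning

  module _ (balance : Balanced) where
    open Balanced balance

    -- A side is crossed by at most `K + 1` edges that cross the light chord `xy` and at most `K`
    -- others, hence by at most `2K + 1`.
    split-at : ∀ x y w → cnt x y ≤ suc K → p < w → w < q →
      (∀ {g h} → (g , h) ∈ es → Cross p w (g , h) → Cross x y (g , h) ⊎ Before p q s (g , h)) →
      (∀ {g h} → (g , h) ∈ es → Cross w q (g , h) → Cross x y (g , h) ⊎ After p q s (g , h)) →
      Good
    split-at x y w light p<w w<q L R = good w p<w w<q
      (≤-trans (count-⊎ (Cross? p w) (Cross? x y) (Before? p q s) es L) (+-mono-≤ light before≤))
      (≤-trans (count-⊎ (Cross? w q) (Cross? x y) (After? p q s) es R) (+-mono-≤ light after≤))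

    -- An edge crossing `ps` or `sq` but not `pq` would pass over `s` while staying under `pq`.
    split-middle : (∀ {e} → e ∈ es → ¬ Span p q s e) → Good
    split-middle none = good s p<s s<q
      (≤-trans (count-⊆ (Cross? p s) (Before? p q s) es λ {(g , h)} g∈ →
         order (0 ≺ 2 ⇒ 2 ≺ 1 ⇒ ~ span 0 1 2 3 4 ⇒ cross 0 2 3 4 ⇒ before 0 1 2 3 4)
           (p ∷ q ∷ s ∷ g ∷ h ∷ []) p<s s<q (none g∈)) (≤-trans before≤ (m≤n+m K (suc K))))
      (≤-trans (count-⊆ (Cross? s q) (After? p q s) es λ {(g , h)} g∈ →
         order (0 ≺ 2 ⇒ 2 ≺ 1 ⇒ ~ span 0 1 2 3 4 ⇒ cross 2 1 3 4 ⇒ after 0 1 2 3 4)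
           (p ∷ q ∷ s ∷ g ∷ h ∷ []) p<s s<q (none g∈)) (≤-trans after≤ (m≤n+m K (suc K))))

    module _ {a b : ℕ} (e∈ : (a , b) ∈ es) (spans : Span p q s (a , b))
             (outermost : ∀ {g h} → (g , h) ∈ es → Span p q s (g , h) → ¬ Around (g , h) (a , b)) where

      -- The apex is `a` if `p < a`; otherwise `a` is `p`, and the apex is `b`, which is below `q`
      -- as `ab` is not `pq`. An edge crossing a side but neither `ab` nor `pq` would surround `ab`,
      -- which is outermost.
      split-light : cnt a b ≤ suc K → Good
      split-light light with p <? a
      ... | yes p<a = split-at a b a light p<a (order (span 0 1 2 3 4 ⇒ 3 ≺ 1) vs spans)
        (λ {g} {h} g∈ → order (0 ≺ 3 ⇒ span 0 1 2 3 4 ⇒ (span 0 1 2 5 6 ⇒ ~ around 5 6 3 4) ⇒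
           cross 0 3 5 6 ⇒ cross 3 4 5 6 ⊔ᶠ before 0 1 2 5 6)
           (p ∷ q ∷ s ∷ a ∷ b ∷ g ∷ h ∷ []) p<a spans (outermost g∈))
        (λ {g} {h} g∈ → order (0 ≺ 3 ⇒ span 0 1 2 3 4 ⇒ (span 0 1 2 5 6 ⇒ ~ around 5 6 3 4) ⇒
           cross 3 1 5 6 ⇒ cross 3 4 5 6 ⊔ᶠ after 0 1 2 5 6)
           (p ∷ q ∷ s ∷ a ∷ b ∷ g ∷ h ∷ []) p<a spans (outermost g∈))
        where vs = p ∷ q ∷ s ∷ a ∷ b ∷ []
      ... | no p≮a = split-at a b b light
        (order (span 0 1 2 3 4 ⇒ 0 ≺ 4) vs spans)
        (order (span 0 1 2 3 4 ⇒ ~ 0 ≺ 3 ⇒ 4 ≺ 1) vs spans p≮a)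
        (λ {g} {h} g∈ → order (~ 0 ≺ 3 ⇒ span 0 1 2 3 4 ⇒ (span 0 1 2 5 6 ⇒ ~ around 5 6 3 4) ⇒
           cross 0 4 5 6 ⇒ cross 3 4 5 6 ⊔ᶠ before 0 1 2 5 6)
           (p ∷ q ∷ s ∷ a ∷ b ∷ g ∷ h ∷ []) p≮a spans (outermost g∈))
        (λ {g} {h} g∈ → order (~ 0 ≺ 3 ⇒ span 0 1 2 3 4 ⇒ (span 0 1 2 5 6 ⇒ ~ around 5 6 3 4) ⇒
           cross 4 1 5 6 ⇒ cross 3 4 5 6 ⊔ᶠ after 0 1 2 5 6)
           (p ∷ q ∷ s ∷ a ∷ b ∷ g ∷ h ∷ []) p≮a spans (outermost g∈))
        where vs = p ∷ q ∷ s ∷ a ∷ b ∷ []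

      module _ (heavy : ¬ cnt a b ≤ suc K) where

        crosser-light : ∀ {x y} → (x , y) ∈ es → Cross a b (x , y) → cnt x y ≤ suc K
        crosser-light f∈ c with minPlanar e∈ f∈ c
        ... | inj₁ light = contradiction light heavy
        ... | inj₂ light = light

        Both : Edge → Set
        Both f = Cross a b f × Cross p q f

        -- The inner end `z` of `xy` lies strictly under `ab`. An edge that crosses a side but not
        -- `pq` has ends on both sides of `xy` and crosses it. An edge that crosses `pq` and ends
        -- between `s` and `z`, or at `s`, would also cross `ab` and be nearer.
        split-nearest : ∀ {x y} → (x , y) ∈ es → Both (x , y) →
          (∀ {g} → g ∈ es → Both g → ¬ Nearer s (inner p g) (inner p (x , y))) → Good
        split-nearest {x} {y} f∈ f nearest = split-at x y z (crosser-light f∈ (proj₁ f))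
          (order (isInner 0 5 6 7 ⇒ cross 0 1 5 6 ⇒ 0 ≺ 7) vs iz (proj₂ f))
          (order (isInner 0 5 6 7 ⇒ cross 0 1 5 6 ⇒ 7 ≺ 1) vs iz (proj₂ f))
          (λ {g} {h} g∈ → order (isInner 0 5 6 7 ⇒ span 0 1 2 3 4 ⇒ cross 3 4 5 6 ⊓ᶠ cross 0 1 5 6 ⇒
             isInner 0 8 9 10 ⇒ 8 ≺ 9 ⇒ (cross 3 4 8 9 ⊓ᶠ cross 0 1 8 9 ⇒ ~ nearer 2 10 7) ⇒
             cross 0 7 8 9 ⇒ cross 5 6 8 9 ⊔ᶠ before 0 1 2 8 9)
             (p ∷ q ∷ s ∷ a ∷ b ∷ x ∷ y ∷ z ∷ g ∷ h ∷ inner p (g , h) ∷ [])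
             iz spans f (inner-spec p g h) (lo<hi g∈) (nearest g∈))
          (λ {g} {h} g∈ → order (isInner 0 5 6 7 ⇒ span 0 1 2 3 4 ⇒ cross 3 4 5 6 ⊓ᶠ cross 0 1 5 6 ⇒
             isInner 0 8 9 10 ⇒ 8 ≺ 9 ⇒ (cross 3 4 8 9 ⊓ᶠ cross 0 1 8 9 ⇒ ~ nearer 2 10 7) ⇒
             cross 7 1 8 9 ⇒ cross 5 6 8 9 ⊔ᶠ after 0 1 2 8 9)
             (p ∷ q ∷ s ∷ a ∷ b ∷ x ∷ y ∷ z ∷ g ∷ h ∷ inner p (g , h) ∷ [])
             iz spans f (inner-spec p g h) (lo<hi g∈) (nearest g∈))
          where
          z = inner p (x , y)
          iz = inner-spec p x y
          vs = p ∷ q ∷ s ∷ a ∷ b ∷ x ∷ y ∷ z ∷ []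

        module _ (apart : ∀ {g} → g ∈ es → ¬ Both g) where

          module _ {x y : ℕ} (f∈ : (x , y) ∈ es) (f : LeftX p a b (x , y))
                   (widest : ∀ {g} → g ∈ es → LeftX p a b g → ¬ Around g (x , y)) where

            private
              vs : List ℕ → List ℕ
              vs gh = p ∷ q ∷ s ∷ a ∷ b ∷ x ∷ y ∷ gh

              hyps : Form
              hyps = span 0 1 2 3 4 ⊓ᶠ leftX 0 3 4 5 6 ⊓ᶠ 7 ≺ 8
                   ⊓ᶠ (leftX 0 3 4 7 8 ⇒ ~ around 7 8 5 6)
                   ⊓ᶠ (span 0 1 2 7 8 ⇒ ~ around 7 8 3 4)
                   ⊓ᶠ ~ (cross 3 4 7 8 ⊓ᶠ cross 0 1 7 8)

              known : ∀ {g h} → (g , h) ∈ es → Semantics.⟦_⟧ (env (vs (g ∷ h ∷ []))) hyps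
              known g∈ = spans , f , lo<hi g∈ , widest g∈ , outermost g∈ , apart g∈

              light : cnt x y ≤ suc K
              light = crosser-light f∈ (order (leftX 0 3 4 5 6 ⇒ cross 3 4 5 6) (vs []) f)

            -- The apex is `x`, or `y` if `x` is `p`. An edge crossing a side but neither `xy` nor
            -- `pq` would surround `xy`, against `widest` if it ends before `b` and against
            -- `outermost` otherwise. By `apart`, an edge crossing `pq` has no end strictly under
            -- `ab`, so its inner end is clearly before or after `s`.
            split-left : Good
            split-left with p <? x
            ... | yes near = split-at x y x light near
              (order (span 0 1 2 3 4 ⇒ leftX 0 3 4 5 6 ⇒ 0 ≺ 5 ⇒ 5 ≺ 1) (vs []) spans f near)
              (λ {g} {h} g∈ → order (hyps ⇒ 0 ≺ 5 ⇒ cross 0 5 7 8 ⇒ cross 5 6 7 8 ⊔ᶠ before 0 1 2 7 8)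
                 (vs (g ∷ h ∷ [])) (known g∈) near)
              (λ {g} {h} g∈ → order (hyps ⇒ 0 ≺ 5 ⇒ cross 5 1 7 8 ⇒ cross 5 6 7 8 ⊔ᶠ after 0 1 2 7 8)
                 (vs (g ∷ h ∷ [])) (known g∈) near)
            ... | no far = split-at x y y light
              (order (span 0 1 2 3 4 ⇒ leftX 0 3 4 5 6 ⇒ ~ 0 ≺ 5 ⇒ 0 ≺ 6) (vs []) spans f far)
              (order (span 0 1 2 3 4 ⇒ leftX 0 3 4 5 6 ⇒ ~ 0 ≺ 5 ⇒ 6 ≺ 1) (vs []) spans f far)
              (λ {g} {h} g∈ → order (hyps ⇒ ~ 0 ≺ 5 ⇒ cross 0 6 7 8 ⇒ cross 5 6 7 8 ⊔ᶠ before 0 1 2 7 8)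
                 (vs (g ∷ h ∷ [])) (known g∈) far)
              (λ {g} {h} g∈ → order (hyps ⇒ ~ 0 ≺ 5 ⇒ cross 6 1 7 8 ⇒ cross 5 6 7 8 ⊔ᶠ after 0 1 2 7 8)
                 (vs (g ∷ h ∷ [])) (known g∈) far)

          module _ {x y : ℕ} (f∈ : (x , y) ∈ es) (f : RightX q a b (x , y))
                   (widest : ∀ {g} → g ∈ es → RightX q a b g → ¬ Around g (x , y)) where

            private
              vs : List ℕ → List ℕ
              vs gh = p ∷ q ∷ s ∷ a ∷ b ∷ x ∷ y ∷ gh

              hyps : Form
              hyps = span 0 1 2 3 4 ⊓ᶠ rightX 1 3 4 5 6 ⊓ᶠ 7 ≺ 8
                   ⊓ᶠ (rightX 1 3 4 7 8 ⇒ ~ around 7 8 5 6)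
                   ⊓ᶠ (span 0 1 2 7 8 ⇒ ~ around 7 8 3 4)
                   ⊓ᶠ ~ (cross 3 4 7 8 ⊓ᶠ cross 0 1 7 8)

              known : ∀ {g h} → (g , h) ∈ es → Semantics.⟦_⟧ (env (vs (g ∷ h ∷ []))) hyps
              known g∈ = spans , f , lo<hi g∈ , widest g∈ , outermost g∈ , apart g∈

              light : cnt x y ≤ suc K
              light = crosser-light f∈ (order (rightX 1 3 4 5 6 ⇒ cross 3 4 5 6) (vs []) f)

            -- Mirror image of `split-left`, with apex `y`, or `x` if `y` is `q`.
            split-right : Good
            split-right with y <? q
            ... | yes near = split-at x y y light
              (order (span 0 1 2 3 4 ⇒ rightX 1 3 4 5 6 ⇒ 6 ≺ 1 ⇒ 0 ≺ 6) (vs []) spans f near) near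
              (λ {g} {h} g∈ → order (hyps ⇒ 6 ≺ 1 ⇒ cross 0 6 7 8 ⇒ cross 5 6 7 8 ⊔ᶠ before 0 1 2 7 8)
                 (vs (g ∷ h ∷ [])) (known g∈) near)
              (λ {g} {h} g∈ → order (hyps ⇒ 6 ≺ 1 ⇒ cross 6 1 7 8 ⇒ cross 5 6 7 8 ⊔ᶠ after 0 1 2 7 8)
                 (vs (g ∷ h ∷ [])) (known g∈) near)
            ... | no far = split-at x y x light
              (order (span 0 1 2 3 4 ⇒ rightX 1 3 4 5 6 ⇒ ~ 6 ≺ 1 ⇒ 0 ≺ 5) (vs []) spans f far)
              (order (span 0 1 2 3 4 ⇒ rightX 1 3 4 5 6 ⇒ ~ 6 ≺ 1 ⇒ 5 ≺ 1) (vs []) spans f far)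
              (λ {g} {h} g∈ → order (hyps ⇒ ~ 6 ≺ 1 ⇒ cross 0 5 7 8 ⇒ cross 5 6 7 8 ⊔ᶠ before 0 1 2 7 8)
                 (vs (g ∷ h ∷ [])) (known g∈) far)
              (λ {g} {h} g∈ → order (hyps ⇒ ~ 6 ≺ 1 ⇒ cross 5 1 7 8 ⇒ cross 5 6 7 8 ⊔ᶠ after 0 1 2 7 8)
                 (vs (g ∷ h ∷ [])) (known g∈) far)

        split-heavy : Good
        split-heavy with least (λ g → Cross? a b g ×-dec Cross? p q g)
                               (λ g g′ → Nearer? s (inner p g) (inner p g′))
                               (Nearer-trans s) (Nearer-irrefl s) es
        ... | inj₂ (f , f∈ , both , nearest) = split-nearest f∈ both nearest
        -- Being heavy, `ab` is crossed by some edge. As this edge does not cross `pq`, both its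
        -- ends lie between `p` and `q` inclusive, to the left or to the right of `ab` for the outer
        -- one.
        ... | inj₁ none with count-some (Cross? a b) es (<-≤-trans z<s (≰⇒≥ heavy))
        ...   | (x , y) , f∈ , c
              with order (span 0 1 2 3 4 ⇒ cross 3 4 5 6 ⇒ ~ (cross 3 4 5 6 ⊓ᶠ cross 0 1 5 6) ⇒
                          leftX 0 3 4 5 6 ⊔ᶠ rightX 1 3 4 5 6)
                     (p ∷ q ∷ s ∷ a ∷ b ∷ x ∷ y ∷ []) spans c (none f∈)
        ...     | inj₁ l with least (LeftX? p a b) Around? Around-trans Around-irrefl es
        ...       | inj₁ noLeft = contradiction l (noLeft f∈)
        ...       | inj₂ (_ , g∈ , l′ , widest) = split-left none g∈ l′ widest
        split-heavy | inj₁ none | (x , y) , f∈ , c | inj₂ r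
              with least (RightX? q a b) Around? Around-trans Around-irrefl es
        ...       | inj₁ noRight = contradiction r (noRight f∈)
        ...       | inj₂ (_ , g∈ , r′ , widest) = split-right none g∈ r′ widest

    split-balanced : Good
    split-balanced with least (Span? p q s) Around? Around-trans Around-irrefl es
    ... | inj₁ none = split-middle none
    ... | inj₂ ((a , b) , e∈ , spans , outermost) with cnt a b ≤? suc K
    ...   | yes light = split-light e∈ spans outermost light
    ...   | no  heavy = split-heavy e∈ spans outermost heavy

  splitting-point : cnt p q ≤ suc K + K → suc p < q → Good
  splitting-point cross≤ p+1<q = split-balanced (balanced-point cross≤ p+1<q)

-- Tree decompositions grown by attaching leaves

-- Indexed by the number of nodes minus one. The leaf added by `attach` becomes node `zero`, and the
-- older nodes are shifted by `suc`.
data Growth : ℕ → Set where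
  single : List ℕ → Growth 0
  attach : ∀ {m} → Growth m → Fin (suc m) → List ℕ → Growth (suc m)

bagOf : ∀ {m} → Growth m → Fin (suc m) → List ℕ
bagOf (single B)     _       = B
bagOf (attach T t B) zero    = B
bagOf (attach T t B) (suc s) = bagOf T s

adjOf : ∀ {m} → Growth m → Fin (suc m) → Fin (suc m) → Bool
adjOf (single B)     _       _        = false
adjOf (attach T t B) zero    zero     = false
adjOf (attach T t B) zero    (suc s)  = ⌊ s Fin.≟ t ⌋
adjOf (attach T t B) (suc s) zero     = ⌊ s Fin.≟ t ⌋
adjOf (attach T t B) (suc s) (suc s′) = adjOf T s s′

graphOf : ∀ {m} → Growth m → Graph (suc m)
graphOf T .adj = adjOf T
graphOf T .sym = symmetric T
  where
  symmetric : ∀ {m} (T : Growth m) u v → adjOf T u v ≡ adjOf T v u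
  symmetric (single B)     _       _       = refl
  symmetric (attach T t B) zero    zero    = refl
  symmetric (attach T t B) zero    (suc v) = refl
  symmetric (attach T t B) (suc u) zero    = refl
  symmetric (attach T t B) (suc u) (suc v) = symmetric T u v
graphOf T .irrefl = irreflexive T
  where
  irreflexive : ∀ {m} (T : Growth m) u → adjOf T u u ≡ false
  irreflexive (single B)     _       = refl
  irreflexive (attach T t B) zero    = refl
  irreflexive (attach T t B) (suc u) = irreflexive T u

⌊⌋-true : ∀ {P : Set} (P? : Dec P) → P → ⌊ P? ⌋ ≡ true
⌊⌋-true (yes _) _ = refl
⌊⌋-true (no ¬p) p = contradiction p ¬p

true-⌊⌋ : ∀ {P : Set} (P? : Dec P) → ⌊ P? ⌋ ≡ true → P
true-⌊⌋ (yes p) _ = p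

module _ {n} {G : Graph n} where

  walk-snoc : ∀ {P : Fin n → Set} {s t u} → WalkIn G P s t → adj G t u ≡ true → P u → WalkIn G P s u
  walk-snoc (here p)     tu pu = step p tu (here pu)
  walk-snoc (step p e w) tu pu = step p e (walk-snoc w tu pu)

  walk-map : ∀ {P Q : Fin n → Set} → (∀ {s} → P s → Q s) → ∀ {s t} → WalkIn G P s t → WalkIn G Q s t
  walk-map f (here p)     = here (f p)
  walk-map f (step p e w) = step (f p) e (walk-map f w)

module _ {m} {T : Growth m} {u : Fin (suc m)} {B : List ℕ} where

  private T⁺ = graphOf (attach T u B)

  walk-lift : ∀ {Q : Fin (2 + m) → Set} {s t} → WalkIn (graphOf T) (Q ∘ suc) s t → WalkIn T⁺ Q (suc s) (suc t)
  walk-lift (here q)     = here q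
  walk-lift (step q e w) = step q e (walk-lift w)

  -- Stated for a general `Q` to give both connectedness of the tree and connectedness of the set of
  -- nodes whose bags contain a given vertex. A leaf in `Q` must hang from a node in `Q` once `Q`
  -- has an older node.
  attach-walk : ∀ {Q : Fin (2 + m) → Set} → (Q zero → ∀ {s} → Q (suc s) → Q (suc u)) →
    (∀ s t → Q (suc s) → Q (suc t) → WalkIn (graphOf T) (Q ∘ suc) s t) →
    ∀ s t → Q s → Q t → WalkIn T⁺ Q s t
  attach-walk up old zero    zero    q r = here q
  attach-walk up old zero    (suc t) q r = step q (⌊⌋-true (u Fin.≟ u) refl) (walk-lift (old u t (up q r) r))
  attach-walk up old (suc s) zero    q r = walk-snoc (walk-lift (old s u q (up r q))) (⌊⌋-true (u Fin.≟ u) refl) r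
  attach-walk up old (suc s) (suc t) q r = walk-lift (old s t q r)

connected : ∀ {m} (T : Growth m) → Connected (graphOf T)
connected (single B)     zero zero = here tt
connected (attach T u B) s    t    =
  attach-walk (λ _ _ → tt) (λ s t _ _ → connected T s t) s t tt tt

cycle-neighbours : ∀ {n} (G : Graph n) l (c : Fin (3 + l) → Fin n) →
  (∀ (i : Fin (2 + l)) → adj G (c (inject₁ i)) (c (suc i)) ≡ true) →
  adj G (c (fromℕ (2 + l))) (c zero) ≡ true →
  ∀ i → ∃ λ j → ∃ λ j′ → j ≢ j′ × adj G (c i) (c j) ≡ true × adj G (c i) (c j′) ≡ true
cycle-neighbours G l c steps back zero =
  suc zero , fromℕ (2 + l) , (λ ()) , steps zero , trans (sym G _ _) back
cycle-neighbours G l c steps back (suc i) with view i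
... | ‵fromℕ     = inject₁ i , zero , (λ ()) , trans (sym G _ _) (steps i) , back
... | ‵inject₁ k =
  inject₁ i , suc (suc k) , distinct , trans (sym G _ _) (steps i) , steps (suc k)
  where
  distinct : inject₁ (inject₁ k) ≢ suc (suc k)
  distinct eq = <⇒≢ (m<n⇒m<1+n (n<1+n _))
    (trans (≡-sym (trans (Fin.toℕ-inject₁ _) (Fin.toℕ-inject₁ k))) (cong toℕ eq))

-- A vertex of a cycle has two distinct neighbours, but the newest leaf has only one. So a cycle
-- avoids it and lies in the older tree.
acyclic : ∀ {m} (T : Growth m) → Acyclic (graphOf T)
acyclic (single B) l c inj steps back with () ← back
acyclic (attach T u B) l c inj steps back with Fin.any? (λ i → c i Fin.≟ zero)
... | yes (i , ci≡0) with cycle-neighbours (graphOf (attach T u B)) l c steps back i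
...   | j , j′ , j≢j′ , cj , cj′ = j≢j′ (inj (trans (parent (c i) (c j) ci≡0 cj) (≡-sym (parent (c i) (c j′) ci≡0 cj′))))
  where
  parent : ∀ x y → x ≡ zero → adjOf (attach T u B) x y ≡ true → y ≡ suc u
  parent zero (suc y) refl e = cong suc (true-⌊⌋ (y Fin.≟ u) e)
acyclic (attach T u B) l c inj steps back | no c≢0 =
  acyclic T l c′ (λ {i} {j} eq → inj (trans (lower i) (trans (cong suc eq) (≡-sym (lower j)))))
    (λ i → old (steps i)) (old back)
  where
  below : ∀ {n} (x : Fin (suc n)) → x ≢ zero → ∃ λ y → x ≡ suc y
  below zero    x≢0 = contradiction refl x≢0
  below (suc y) x≢0 = y , refl
  c′ = λ i → proj₁ (below (c i) (λ eq → c≢0 (i , eq)))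
  lower : ∀ i → c i ≡ suc (c′ i)
  lower i = proj₂ (below (c i) (λ eq → c≢0 (i , eq)))
  old : ∀ {i j} → adjOf (attach T u B) (c i) (c j) ≡ true → adjOf T (c′ i) (c′ j) ≡ true
  old {i} {j} = subst₂ (λ x y → adjOf (attach T u B) x y ≡ true) (lower i) (lower j)

-- Occurrences in bags and validity

Occurs : ∀ {m} → Growth m → ℕ → Set
Occurs T z = ∃ λ s → z ∈ bagOf T s

Together : ∀ {m} → Growth m → ℕ → ℕ → Set
Together T x y = ∃ λ s → x ∈ bagOf T s × y ∈ bagOf T s

-- Compares bags only, not tree edges; this is what carries `Occurs` and `Together` over to larger
-- trees.
_⊑_ : ∀ {m m′} → Growth m → Growth m′ → Set
T ⊑ T′ = ∀ s → ∃ λ s′ → bagOf T′ s′ ≡ bagOf T s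

⊑-trans : ∀ {m m′ m″} {T : Growth m} {T′ : Growth m′} {T″ : Growth m″} → T ⊑ T′ → T′ ⊑ T″ → T ⊑ T″
⊑-trans f g s with f s
... | s′ , eq with g s′
...   | s″ , eq′ = s″ , trans eq′ eq

Occurs-⊑ : ∀ {m m′} {T : Growth m} {T′ : Growth m′} → T ⊑ T′ → ∀ {z} → Occurs T z → Occurs T′ z
Occurs-⊑ f (s , z∈) with f s
... | s′ , eq = s′ , subst (_ ∈_) (≡-sym eq) z∈

Together-⊑ : ∀ {m m′} {T : Growth m} {T′ : Growth m′} → T ⊑ T′ → ∀ {x y} → Together T x y → Together T′ x y
Together-⊑ f (s , x∈ , y∈) with f s
... | s′ , eq = s′ , subst (_ ∈_) (≡-sym eq) x∈ , subst (_ ∈_) (≡-sym eq) y∈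

record Valid (W : ℕ) {m} (T : Growth m) : Set where
  field
    connects : ∀ z s t → z ∈ bagOf T s → z ∈ bagOf T t → WalkIn (graphOf T) (λ r → z ∈ bagOf T r) s t
    small    : ∀ t → length (bagOf T t) ≤ W
open Valid public

single-valid : ∀ {W B} → length B ≤ W → Valid W (single B)
single-valid B≤W .connects z zero zero z∈ _ = here z∈
single-valid B≤W .small _ = B≤W

attach-valid : ∀ {W m} {T : Growth m} {t B} → Valid W T → length B ≤ W →
  (∀ {z} → z ∈ B → Occurs T z → z ∈ bagOf T t) → Valid W (attach T t B)
attach-valid v B≤W up .connects z =
  attach-walk (λ z∈B {s} z∈s → up z∈B (s , z∈s)) (v .connects z)
attach-valid v B≤W up .small zero    = B≤W
attach-valid v B≤W up .small (suc t) = v .small t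

-- Filling the region under a chord

-- Such an `f` selects the end by which an edge is represented in bags.
IsChoice : (Edge → ℕ) → Set
IsChoice f = ∀ x y → f (x , y) ≡ x ⊎ f (x , y) ≡ y

-- The child chords pw and wq of pq see the edges ending at q, respectively p, through that endpoint.
preferHi preferLo : ℕ → (Edge → ℕ) → Edge → ℕ
preferHi q f (x , y) with y ≟ q
... | yes _ = y
... | no  _ = f (x , y)
preferLo p f (x , y) with x ≟ p
... | yes _ = x
... | no  _ = f (x , y)

preferHi-spec : ∀ q f x y → (y ≡ q × preferHi q f (x , y) ≡ y) ⊎ (¬ y ≡ q × preferHi q f (x , y) ≡ f (x , y))
preferHi-spec q f x y with y ≟ q
... | yes eq = inj₁ (eq , refl)
... | no neq = inj₂ (neq , refl)

preferLo-spec : ∀ p f x y → (x ≡ p × preferLo p f (x , y) ≡ x) ⊎ (¬ x ≡ p × preferLo p f (x , y) ≡ f (x , y))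
preferLo-spec p f x y with x ≟ p
... | yes eq = inj₁ (eq , refl)
... | no neq = inj₂ (neq , refl)

preferHi-choice : ∀ q {f} → IsChoice f → IsChoice (preferHi q f)
preferHi-choice q choice x y with y ≟ q
... | yes _ = inj₂ refl
... | no  _ = choice x y

preferLo-choice : ∀ p {f} → IsChoice f → IsChoice (preferLo p f)
preferLo-choice p choice x y with x ≟ p
... | yes _ = inj₁ refl
... | no  _ = choice x y

two : ℕ → ℕ → ℕ → ℕ → ℕ → Form
two p q w x y = (cross p w x y ⊓ᶠ cross w q x y) ⊔ᶠ (cross p w x y ⊓ᶠ cross p q x y)
             ⊔ᶠ (cross w q x y ⊓ᶠ cross p q x y)

Two : ℕ → ℕ → ℕ → Edge → Set
Two p q w e = (Cross p w e × Cross w q e) ⊎ (Cross p w e × Cross p q e) ⊎ (Cross w q e × Cross p q e)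

Two? : ∀ p q w e → Dec (Two p q w e)
Two? p q w (x , y) = decide (two 0 1 2 3 4) (p ∷ q ∷ w ∷ x ∷ y ∷ [])

-- The edge comes in across `pq` or joins the interiors of the two sides. Once the triangle is
-- attached, `w` and representatives of such edges are all that occurs strictly under `pq`, by
-- `occurs₂`.
entering : ℕ → ℕ → ℕ → ℕ → ℕ → Form
entering p q w x y = cross p q x y ⊔ᶠ (cross p w x y ⊓ᶠ cross w q x y)

Entering : ℕ → ℕ → ℕ → Edge → Set
Entering p q w e = Cross p q e ⊎ (Cross p w e × Cross w q e)

-- An edge xy whose representative is z is the responsibility of the chord pq if it lies under pq
-- or if it crosses pq and z is its end beyond pq.
owned : ℕ → ℕ → ℕ → ℕ → ℕ → Form
owned p q x y z = (p ≼ x ⊓ᶠ y ≼ q ⊓ᶠ (p ≺ x ⊔ᶠ y ≺ q))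
               ⊔ᶠ (p ≺ x ⊓ᶠ x ≺ q ⊓ᶠ q ≺ y ⊓ᶠ z ≈ y)
               ⊔ᶠ (x ≺ p ⊓ᶠ p ≺ y ⊓ᶠ y ≺ q ⊓ᶠ z ≈ x)

Owned : ℕ → ℕ → ℕ → ℕ → ℕ → Set
Owned p q x y z = (p ≤ x × y ≤ q × (p < x ⊎ y < q))
                ⊎ (p < x × x < q × q < y × z ≡ y)
                ⊎ (x < p × p < y × y < q × z ≡ x)

chosen : ℕ → ℕ → ℕ → Form
chosen x y z = z ≈ x ⊔ᶠ z ≈ y

module Filling
  (es : List Edge) (lo<hi : ∀ {x y} → (x , y) ∈ es → x < y) (K : ℕ)
  (minPlanar : ∀ {a b x y} → (a , b) ∈ es → (x , y) ∈ es → Cross a b (x , y) →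
               crossings es a b ≤ suc K ⊎ crossings es x y ≤ suc K)
  where

  private
    cnt : ℕ → ℕ → ℕ
    cnt = crossings es

  -- The bag size allowed by width `3k + 1` for `k = K + 1`.
  W : ℕ
  W = suc (3 * suc K + 1)

  ends : (Edge → ℕ) → {P : Pred Edge 0ℓ} → Decidable P → List ℕ
  ends f P? = map f (filter P? es)

  module _ (f : Edge → ℕ) {P : Pred Edge 0ℓ} (P? : Decidable P) where

    ∈-ends⁺ : ∀ {e} → e ∈ es → P e → f e ∈ ends f P?
    ∈-ends⁺ e∈ p = ∈-map⁺ f (∈-filter⁺ P? e∈ p)

    ∈-ends⁻ : ∀ {z} → z ∈ ends f P? → ∃ λ e → e ∈ es × P e × z ≡ f e
    ∈-ends⁻ z∈ with ∈-map⁻ f z∈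
    ... | e , e∈ , eq with ∈-filter⁻ P? {xs = es} e∈
    ...   | e∈es , p = e , e∈es , p , eq

    ends-length : length (ends f P?) ≡ count P? es
    ends-length = length-map f (filter P? es)

  guard : ℕ → ℕ → (Edge → ℕ) → List ℕ
  guard p q f = p ∷ q ∷ ends f (Cross? p q)

  -- The outcome of filling the region under `pq`. By `new`, filling the left child chord adds no
  -- vertices under the right one.
  record Filled (p q : ℕ) (f : Edge → ℕ) {m} (T : Growth m) : Set where
    field
      {m′}     : ℕ
      T′       : Growth m′
      valid    : Valid W T′
      extends′ : T ⊑ T′
      new      : ∀ {z} → Occurs T′ z → Occurs T z ⊎ (p < z × z < q)
      vertices : ∀ {z} → p < z → z < q → Occurs T′ z
      edges    : ∀ {x y} → (x , y) ∈ es → Owned p q x y (f (x , y)) → Together T′ x y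

  guard-small : ∀ {p q f} w → cnt p q ≤ suc K + K → length (w ∷ guard p q f) ≤ W
  guard-small {p} {q} {f} w cross≤ = begin
    3 + length (ends f (Cross? p q))    ≡⟨ cong (3 +_) (ends-length f (Cross? p q)) ⟩
    3 + cnt p q                         ≤⟨ +-monoʳ-≤ 3 cross≤ ⟩
    3 + (suc K + K)                     ≤⟨ m≤m+n _ (suc K) ⟩
    3 + (suc K + K) + suc K             ≡⟨ solve 1 (λ k →
       con 3 :+ (con 1 :+ k :+ k) :+ (con 1 :+ k) := con 1 :+ (con 3 :* (con 1 :+ k) :+ con 1)) refl K ⟩
    W                                   ∎
    where open ≤-Reasoning
          open +-*-Solver

  -- Twice `3K + 2` is `6K + 4`, one more than `3 (2K + 1)`.
  halve : ∀ c → c + c ≤ (suc K + K) + ((suc K + K) + (suc K + K)) → c ≤ suc (3 * K)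
  halve c c+c≤ with c ≤? suc (3 * K)
  ... | yes c≤ = c≤
  ... | no  c≰ = contradiction (≤-trans (+-mono-≤ (≰⇒> c≰) (≰⇒> c≰)) c+c≤)
      (<⇒≱ (≤-reflexive (solve 1 (λ k →
        let m = con 1 :+ k :+ k in let c = con 2 :+ con 3 :* k in con 1 :+ (m :+ (m :+ m)) := c :+ c) refl K)))
    where open +-*-Solver

  triangle-small : ∀ {p q f} w → cnt p w ≤ suc K + K → cnt w q ≤ suc K + K → cnt p q ≤ suc K + K →
    length (p ∷ q ∷ w ∷ ends f (Two? p q w)) ≤ W
  triangle-small {p} {q} {f} w l r o = begin
    3 + length (ends f (Two? p q w))    ≡⟨ cong (3 +_) (ends-length f (Two? p q w)) ⟩
    3 + count (Two? p q w) es           ≤⟨ +-monoʳ-≤ 3 (halve _ (≤-trans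
        (count-twice (Cross? p w) (Cross? w q) (Cross? p q) (Two? p q w) es (λ _ → id))
        (+-mono-≤ l (+-mono-≤ r o)))) ⟩
    3 + suc (3 * K)                     ≤⟨ n≤1+n _ ⟩
    4 + suc (3 * K)                     ≡⟨ solve 1 (λ k →
       con 4 :+ (con 1 :+ con 3 :* k) := con 1 :+ (con 3 :* (con 1 :+ k) :+ con 1)) refl K ⟩
    W                                   ∎
    where open ≤-Reasoning
          open +-*-Solver

  module Triangle {p q f} (choice : IsChoice f) (cross≤ : cnt p q ≤ suc K + K)
    {w} (p<w : p < w) (w<q : w < q) (left-light : cnt p w ≤ suc K + K) (right-light : cnt w q ≤ suc K + K)
    {m} (T : Growth m) t (v : Valid W T) (guard⊆ : ∀ {z} → z ∈ guard p q f → z ∈ bagOf T t)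
    (fresh : ∀ {z} → p < z → z < q → Occurs T z → z ∈ guard p q f)
    where

    f₁ f₂ : Edge → ℕ
    f₁ = preferHi q f
    f₂ = preferLo p f
    B₁ B₂ : List ℕ
    B₁ = w ∷ guard p q f
    B₂ = p ∷ q ∷ w ∷ ends f (Two? p q w)
    T₁ : Growth (suc m)
    T₁ = attach T t B₁
    T₂ : Growth (2 + m)
    T₂ = attach T₁ zero B₂

    chosen-by : ∀ {e z} → z ≡ f e → z ≡ proj₁ e ⊎ z ≡ proj₂ e
    chosen-by {x , y} refl = choice x y

    -- An edge that crosses two sides but not `pq` crosses `pw` and `wq`, so both its ends lie
    -- strictly under `pq`.
    two-end : ∀ {x y z} → z ≡ f (x , y) → Two p q w (x , y) → Cross p q (x , y) ⊎ (p < z × z < q)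
    two-end {x} {y} {z} z≡ = order (chosen 3 4 5 ⇒ two 0 1 2 3 4 ⇒ cross 0 1 3 4 ⊔ᶠ (0 ≺ 5 ⊓ᶠ 5 ≺ 1))
      (p ∷ q ∷ w ∷ x ∷ y ∷ z ∷ []) (chosen-by z≡)

    v₁ : Valid W T₁
    v₁ = attach-valid v (guard-small {f = f} w cross≤) up
      where
      up : ∀ {z} → z ∈ B₁ → Occurs T z → z ∈ bagOf T t
      up (head refl) o = guard⊆ (fresh p<w w<q o)
      up (tail z∈) o = guard⊆ z∈

    v₂ : Valid W T₂
    v₂ = attach-valid v₁ (triangle-small {f = f} w left-light right-light cross≤) up
      where
      up : ∀ {z} → z ∈ B₂ → Occurs T₁ z → z ∈ B₁
      up (head refl) _ = tail (head refl)
      up (tail (head refl)) _ = tail (tail (head refl))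
      up (tail (tail (head refl))) _ = head refl
      up (tail (tail (tail _))) (zero , z∈) = z∈
      up (tail (tail (tail z∈))) (suc s , z∈s) with ∈-ends⁻ f (Two? p q w) z∈
      ... | _ , e∈ , t , z≡ with two-end z≡ t
      ...   | inj₁ c           = tail (tail (tail (subst (_∈ _) (≡-sym z≡) (∈-ends⁺ f (Cross? p q) e∈ c))))
      ...   | inj₂ (p<z , z<q) = tail (fresh p<z z<q (s , z∈s))

    occurs₂ : ∀ {z} → Occurs T₂ z → p < z → z < q →
              z ≡ w ⊎ ∃ λ e → e ∈ es × Entering p q w e × z ≡ f e
    occurs₂ = go
      where
      fromGuard : ∀ {z} → z ∈ guard p q f → p < z → z < q →
                  ∃ λ e → e ∈ es × Entering p q w e × z ≡ f e
      fromGuard (head refl) p<z z<q = contradiction p<z (<-irrefl refl)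
      fromGuard (tail (head refl)) p<z z<q = contradiction z<q (<-irrefl refl)
      fromGuard (tail (tail z∈)) _ _ with ∈-ends⁻ f (Cross? p q) z∈
      ... | e , e∈ , c , z≡ = e , e∈ , inj₁ c , z≡
      go : ∀ {z} → Occurs T₂ z → p < z → z < q → z ≡ w ⊎ ∃ λ e → e ∈ es × Entering p q w e × z ≡ f e
      go (zero , head refl) p<z z<q = contradiction p<z (<-irrefl refl)
      go (zero , tail (head refl)) p<z z<q = contradiction z<q (<-irrefl refl)
      go (zero , tail (tail (head refl))) p<z z<q = inj₁ refl
      go (zero , tail (tail (tail z∈))) p<z z<q with ∈-ends⁻ f (Two? p q w) z∈
      ... | (x , y) , e∈ , t , z≡ =
        inj₂ (_ , e∈ , order (two 0 1 2 3 4 ⇒ entering 0 1 2 3 4) (p ∷ q ∷ w ∷ x ∷ y ∷ []) t , z≡)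
      go (suc zero , head refl) p<z z<q = inj₁ refl
      go (suc zero , tail z∈) p<z z<q = inj₂ (fromGuard z∈ p<z z<q)
      go (suc (suc s) , z∈) p<z z<q = inj₂ (fromGuard (fresh p<z z<q (s , z∈)) p<z z<q)

    -- An edge entering the triangle through `pw` leaves it through another side, and then its
    -- representative is in `B₂`, or ends at `q`, and then `f₁` represents it by `q`.
    left⊆ : ∀ {z} → z ∈ guard p w f₁ → z ∈ B₂
    left⊆ (head refl) = head refl
    left⊆ (tail (head refl)) = tail (tail (head refl))
    left⊆ (tail (tail z∈)) with ∈-ends⁻ f₁ (Cross? p w) z∈
    ... | (x , y) , e∈ , c , refl with preferHi-spec q f x y
    ...   | inj₁ (refl , eq) = subst (_∈ B₂) (≡-sym eq) (tail (head refl))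
    ...   | inj₂ (y≢q , eq) = subst (_∈ B₂) (≡-sym eq) (tail (tail (tail (∈-ends⁺ f (Two? p q w) e∈
            (order (0 ≺ 2 ⇒ 2 ≺ 1 ⇒ cross 0 2 3 4 ⇒ ~ 4 ≈ 1 ⇒ two 0 1 2 3 4)
              (p ∷ q ∷ w ∷ x ∷ y ∷ []) p<w w<q c y≢q)))))

    -- The occurrence comes from an entering edge with an end under `pw`. That edge does not end at
    -- `q`, so `f₁` agrees with `f` on it.
    left-fresh : ∀ {z} → p < z → z < w → Occurs T₂ z → z ∈ guard p w f₁
    left-fresh p<z z<w o with occurs₂ o p<z (<-trans z<w w<q)
    ... | inj₁ refl = contradiction z<w (<-irrefl refl)
    ... | inj₂ ((x , y) , e∈ , en , z≡)
          with order (2 ≺ 1 ⇒ 3 ≺ 4 ⇒ chosen 3 4 5 ⇒ entering 0 1 2 3 4 ⇒ 0 ≺ 5 ⇒ 5 ≺ 2 ⇒ cross 0 2 3 4 ⊓ᶠ ~ 4 ≈ 1)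
                 (p ∷ q ∷ w ∷ x ∷ y ∷ _ ∷ []) w<q (lo<hi e∈) (chosen-by z≡) en p<z z<w
    ...   | c , y≢q with preferHi-spec q f x y
    ...     | inj₁ (y≡q , _) = contradiction y≡q y≢q
    ...     | inj₂ (_ , eq)  = tail (tail (subst (_∈ _) (trans eq (≡-sym z≡)) (∈-ends⁺ f₁ (Cross? p w) e∈ c)))

    module Left (L : Filled p w f₁ T₂) where
      module L = Filled L

      s₂ : Fin (suc L.m′)
      s₂ = proj₁ (L.extends′ zero)

      right⊆ : ∀ {z} → z ∈ guard w q f₂ → z ∈ B₂
      right⊆ (head refl) = tail (tail (head refl))
      right⊆ (tail (head refl)) = tail (head refl)
      right⊆ (tail (tail z∈)) with ∈-ends⁻ f₂ (Cross? w q) z∈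
      ... | (x , y) , e∈ , c , refl with preferLo-spec p f x y
      ...   | inj₁ (refl , eq) = subst (_∈ B₂) (≡-sym eq) (head refl)
      ...   | inj₂ (x≢p , eq) = subst (_∈ B₂) (≡-sym eq) (tail (tail (tail (∈-ends⁺ f (Two? p q w) e∈
              (order (0 ≺ 2 ⇒ 2 ≺ 1 ⇒ cross 2 1 3 4 ⇒ ~ 3 ≈ 0 ⇒ two 0 1 2 3 4)
                (p ∷ q ∷ w ∷ x ∷ y ∷ []) p<w w<q c x≢p)))))

      -- By `L.new`, an occurrence strictly between `w` and `q` was already present in `T₂`; the
      -- rest mirrors `left-fresh`.
      right-fresh : ∀ {z} → w < z → z < q → Occurs L.T′ z → z ∈ guard w q f₂
      right-fresh w<z z<q o with L.new o
      ... | inj₂ (_ , z<w) = contradiction w<z (<-asym z<w)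
      ... | inj₁ o₂ with occurs₂ o₂ (<-trans p<w w<z) z<q
      ...   | inj₁ refl = contradiction w<z (<-irrefl refl)
      ...   | inj₂ ((x , y) , e∈ , en , z≡)
              with order (0 ≺ 2 ⇒ 3 ≺ 4 ⇒ chosen 3 4 5 ⇒ entering 0 1 2 3 4 ⇒ 2 ≺ 5 ⇒ 5 ≺ 1 ⇒ cross 2 1 3 4 ⊓ᶠ ~ 3 ≈ 0)
                     (p ∷ q ∷ w ∷ x ∷ y ∷ _ ∷ []) p<w (lo<hi e∈) (chosen-by z≡) en w<z z<q
      ...     | c , x≢p with preferLo-spec p f x y
      ...       | inj₁ (x≡p , _) = contradiction x≡p x≢p
      ...       | inj₂ (_ , eq)  = tail (tail (subst (_∈ _) (trans eq (≡-sym z≡)) (∈-ends⁺ f₂ (Cross? w q) e∈ c)))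

      right⊆′ : ∀ {z} → z ∈ guard w q f₂ → z ∈ bagOf L.T′ s₂
      right⊆′ z∈ = subst (_ ∈_) (≡-sym (proj₂ (L.extends′ zero))) (right⊆ z∈)

      module Right (R : Filled w q f₂ L.T′) where
        module R = Filled R

        T₂⊑ : T₂ ⊑ R.T′
        T₂⊑ = ⊑-trans {T = T₂} {L.T′} {R.T′} L.extends′ R.extends′

        new : ∀ {z} → Occurs R.T′ z → Occurs T z ⊎ (p < z × z < q)
        new o with R.new o
        ... | inj₂ (w<z , z<q) = inj₂ (<-trans p<w w<z , z<q)
        ... | inj₁ o′ with L.new o′
        ...   | inj₂ (p<z , z<w) = inj₂ (p<z , <-trans z<w w<q)
        ...   | inj₁ (suc (suc s) , z∈) = inj₁ (s , z∈)
        ...   | inj₁ (suc zero , head refl) = inj₂ (p<w , w<q)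
        ...   | inj₁ (suc zero , tail z∈) = inj₁ (t , guard⊆ z∈)
        ...   | inj₁ (zero , head refl) = inj₁ (t , guard⊆ (head refl))
        ...   | inj₁ (zero , tail (head refl)) = inj₁ (t , guard⊆ (tail (head refl)))
        ...   | inj₁ (zero , tail (tail (head refl))) = inj₂ (p<w , w<q)
        ...   | inj₁ (zero , tail (tail (tail z∈))) with ∈-ends⁻ f (Two? p q w) z∈
        ...     | _ , e∈ , t′ , z≡ with two-end z≡ t′
        ...       | inj₁ c = inj₁ (t , guard⊆ (tail (tail (subst (_∈ _) (≡-sym z≡) (∈-ends⁺ f (Cross? p q) e∈ c)))))
        ...       | inj₂ p<z<q = inj₂ p<z<q

        vertices : ∀ {z} → p < z → z < q → Occurs R.T′ z
        vertices {z} p<z z<q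
          with order (0 ≺ 3 ⇒ 3 ≺ 1 ⇒ (0 ≺ 3 ⊓ᶠ 3 ≺ 2) ⊔ᶠ (2 ≺ 3 ⊓ᶠ 3 ≺ 1) ⊔ᶠ 3 ≈ 2)
                 (p ∷ q ∷ w ∷ z ∷ []) p<z z<q
        ... | inj₁ (p<z , z<w)        = Occurs-⊑ {T = L.T′} {R.T′} R.extends′ (L.vertices p<z z<w)
        ... | inj₂ (inj₁ (w<z , z<q)) = R.vertices w<z z<q
        ... | inj₂ (inj₂ refl)        = Occurs-⊑ {T = T₂} {R.T′} T₂⊑ (zero , tail (tail (head refl)))

        -- Responsibility passes to a child chord, with two kinds of exceptions: the edges `pw` and
        -- `wq`, which the triangle bag contains, and edges from `w` across `pq` represented by
        -- their far end. For the latter, `B₁` holds `w` together with the guard.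
        edges : ∀ {x y} → (x , y) ∈ es → Owned p q x y (f (x , y)) → Together R.T′ x y
        edges {x} {y} e∈ o
          with order (0 ≺ 2 ⇒ 2 ≺ 1 ⇒ 3 ≺ 4 ⇒ chosen 3 4 5 ⇒
                      (4 ≈ 1 ⊓ᶠ 6 ≈ 4) ⊔ᶠ (~ 4 ≈ 1 ⊓ᶠ 6 ≈ 5) ⇒
                      (3 ≈ 0 ⊓ᶠ 7 ≈ 3) ⊔ᶠ (~ 3 ≈ 0 ⊓ᶠ 7 ≈ 5) ⇒ owned 0 1 3 4 5 ⇒
                      owned 0 2 3 4 6 ⊔ᶠ owned 2 1 3 4 7 ⊔ᶠ (3 ≈ 0 ⊓ᶠ 4 ≈ 2) ⊔ᶠ (3 ≈ 2 ⊓ᶠ 4 ≈ 1)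
                      ⊔ᶠ (cross 0 1 3 4 ⊓ᶠ 3 ≈ 2 ⊓ᶠ 5 ≈ 4) ⊔ᶠ (cross 0 1 3 4 ⊓ᶠ 4 ≈ 2 ⊓ᶠ 5 ≈ 3))
                 (p ∷ q ∷ w ∷ x ∷ y ∷ f (x , y) ∷ f₁ (x , y) ∷ f₂ (x , y) ∷ [])
                 p<w w<q (lo<hi e∈) (choice x y) (preferHi-spec q f x y) (preferLo-spec p f x y) o
        ... | inj₁ o₁ = Together-⊑ {T = L.T′} {R.T′} R.extends′ (L.edges e∈ o₁)
        ... | inj₂ (inj₁ o₂) = R.edges e∈ o₂
        ... | inj₂ (inj₂ (inj₁ (refl , refl))) =
          Together-⊑ {T = T₂} {R.T′} T₂⊑ (zero , head refl , tail (tail (head refl)))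
        ... | inj₂ (inj₂ (inj₂ (inj₁ (refl , refl)))) =
          Together-⊑ {T = T₂} {R.T′} T₂⊑ (zero , tail (tail (head refl)) , tail (head refl))
        ... | inj₂ (inj₂ (inj₂ (inj₂ (inj₁ (c , refl , eq))))) =
          Together-⊑ {T = T₂} {R.T′} T₂⊑
            (suc zero , head refl , tail (tail (tail (subst (_∈ _) eq (∈-ends⁺ f (Cross? p q) e∈ c)))))
        ... | inj₂ (inj₂ (inj₂ (inj₂ (inj₂ (c , refl , eq))))) =
          Together-⊑ {T = T₂} {R.T′} T₂⊑
            (suc zero , tail (tail (tail (subst (_∈ _) eq (∈-ends⁺ f (Cross? p q) e∈ c)))) , head refl)

        filled : Filled p q f T
        filled = record
          { T′ = R.T′ ; valid = R.valid
          ; extends′ = ⊑-trans {T = T} {T₂} {R.T′} (λ s → suc (suc s) , refl) T₂⊑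
          ; new = new ; vertices = vertices ; edges = edges }

  abstract
    -- Induction on a bound `d` for `q - p`. The guard lies in the bag of `t`, and nothing else
    -- strictly under `pq` occurs yet, so new bags can be attached at `t` while keeping occurrences
    -- connected. The left child is filled first, then the right one at the node `s₂` carrying the
    -- triangle bag.
    fill : ∀ d p q f → IsChoice f → q ≤ p + d → p < q → cnt p q ≤ suc K + K →
      ∀ {m} (T : Growth m) t → Valid W T → (∀ {z} → z ∈ guard p q f → z ∈ bagOf T t) →
      (∀ {z} → p < z → z < q → Occurs T z → z ∈ guard p q f) → Filled p q f T
    fill zero p q f choice q≤p+d p<q _ _ _ _ _ _ =
      contradiction (≤-trans q≤p+d (≤-reflexive (+-identityʳ p))) (<⇒≱ p<q)
    fill (suc d) p q f choice q≤p+d p<q cross≤ T t v guard⊆ fresh with suc p <? q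
    -- Here `q` is `p + 1`: no position lies strictly under the chord, and hence no edge is owned by
    -- it.
    ... | no p+1≮q = record
      { T′ = T ; valid = v ; extends′ = λ s → s , refl ; new = inj₁
      ; vertices = λ p<z z<q → contradiction (≤-trans (s≤s p<z) z<q) p+1≮q
      ; edges = λ {x} {y} e∈ o → ⊥-elim (order
          (4 ≺ 5 ⇒ (0 ≺ 4 ⇒ 1 ≼ 4) ⇒ (0 ≺ 5 ⇒ 1 ≼ 5) ⇒ ~ owned 0 1 4 5 2)
          (p ∷ q ∷ f (x , y) ∷ 0 ∷ x ∷ y ∷ []) (lo<hi e∈) (≤-trans (≮⇒≥ p+1≮q)) (≤-trans (≮⇒≥ p+1≮q)) o) }
    ... | yes p+1<q = Right.filled (fill d w q f₂ (preferLo-choice p choice)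
        (≤-trans q≤p+d (≤-trans (≤-reflexive (+-suc p d)) (+-monoˡ-≤ d p<w))) w<q right-light L.T′ s₂ L.valid
        right⊆′ right-fresh)
      where
      open Splitting.Good (Splitting.splitting-point es lo<hi K minPlanar p q cross≤ p+1<q)
      open Triangle choice cross≤ p<w w<q left-light right-light T t v guard⊆ fresh
      open Left (fill d p w f₁ (preferHi-choice q choice)
        (s≤s⁻¹ (≤-trans w<q (≤-trans q≤p+d (≤-reflexive (+-suc p d))))) p<w left-light T₂ zero v₂ left⊆ left-fresh)

-- From drawings to lists of edges

-- crossesᵇ is definitionally of the form evalᵇ, applied to positions; the semantics is taken at the
-- positions shifted by one, as in Drawing.at below.
module _ (ρ : ℕ → ℕ) where
  open Semantics (suc ∘ ρ)

  evalᵇ : Form → Bool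
  evalᵇ (i ≺ j)  = ⌊ ρ i <? ρ j ⌋
  evalᵇ (i ≼ j)  = ⌊ ρ i ≤? ρ j ⌋
  evalᵇ (i ≈ j)  = ⌊ ρ i ≟ ρ j ⌋
  evalᵇ (φ ⊓ᶠ ψ) = evalᵇ φ ∧ evalᵇ ψ
  evalᵇ (φ ⊔ᶠ ψ) = evalᵇ φ ∨ evalᵇ ψ
  evalᵇ (φ ⇒ ψ)  = not (evalᵇ φ) ∨ evalᵇ ψ
  evalᵇ (φ ⊕ ψ)  = evalᵇ φ xor evalᵇ ψ
  evalᵇ (~ φ)    = not (evalᵇ φ)

  evalᵇ-reflects : ∀ φ → Reflects ⟦ φ ⟧ (evalᵇ φ)
  evalᵇ-reflects (i ≺ j) with ρ i <? ρ j
  ... | yes p = ofʸ (s<s p)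
  ... | no ¬p = ofⁿ (¬p ∘ s<s⁻¹)
  evalᵇ-reflects (i ≼ j) with ρ i ≤? ρ j
  ... | yes p = ofʸ (s≤s p)
  ... | no ¬p = ofⁿ (¬p ∘ s≤s⁻¹)
  evalᵇ-reflects (i ≈ j) with ρ i ≟ ρ j
  ... | yes p = ofʸ (cong suc p)
  ... | no ¬p = ofⁿ (¬p ∘ suc-injective)
  evalᵇ-reflects (φ ⊓ᶠ ψ) = evalᵇ-reflects φ ×-reflects evalᵇ-reflects ψ
  evalᵇ-reflects (φ ⊔ᶠ ψ) = evalᵇ-reflects φ ⊎-reflects evalᵇ-reflects ψ
  evalᵇ-reflects (φ ⇒ ψ)  = evalᵇ-reflects φ →-reflects evalᵇ-reflects ψ
  evalᵇ-reflects (~ φ)    = ¬-reflects (evalᵇ-reflects φ)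
  evalᵇ-reflects (φ ⊕ ψ) with evalᵇ φ | evalᵇ-reflects φ | evalᵇ ψ | evalᵇ-reflects ψ
  ... | _ | ofʸ p  | _ | ofʸ q  = ofⁿ λ { (inj₁ (_ , ¬q)) → ¬q q ; (inj₂ (¬p , _)) → ¬p p }
  ... | _ | ofʸ p  | _ | ofⁿ ¬q = ofʸ (inj₁ (p , ¬q))
  ... | _ | ofⁿ ¬p | _ | ofʸ q  = ofʸ (inj₂ (¬p , q))
  ... | _ | ofⁿ ¬p | _ | ofⁿ ¬q = ofⁿ λ { (inj₁ (p , _)) → ¬p p ; (inj₂ (_ , q)) → ¬q q }

  evalᵇ-true : ∀ φ → ⟦ φ ⟧ → evalᵇ φ ≡ true
  evalᵇ-true φ h with evalᵇ φ | evalᵇ-reflects φ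
  ... | _ | ofʸ _ = refl
  ... | _ | ofⁿ ¬h = contradiction h ¬h

normalise : ℕ → ℕ → Edge
normalise a b with a <? b
... | yes _ = a , b
... | no  _ = b , a

normal : ℕ → ℕ → ℕ → ℕ → Form
normal a b x y = (a ≺ b ⊓ᶠ x ≈ a ⊓ᶠ y ≈ b) ⊔ᶠ (b ≼ a ⊓ᶠ x ≈ b ⊓ᶠ y ≈ a)

Normal : ℕ → ℕ → Edge → Set
Normal a b (x , y) = (a < b × x ≡ a × y ≡ b) ⊎ (b ≤ a × x ≡ b × y ≡ a)

normalise-spec : ∀ a b → Normal a b (normalise a b)
normalise-spec a b with a <? b
... | yes a<b = inj₁ (a<b , refl , refl)
... | no  a≮b = inj₂ (≮⇒≥ a≮b , refl , refl)

Together-normal : ∀ {m} (T : Growth m) {a b x y} → Normal a b (x , y) → Together T x y → Together T a b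
Together-normal T (inj₁ (_ , refl , refl)) (t , x∈ , y∈) = t , x∈ , y∈
Together-normal T (inj₂ (_ , refl , refl)) (t , x∈ , y∈) = t , y∈ , x∈

Together-sym : ∀ {m} {T : Growth m} {a b} → Together T a b → Together T b a
Together-sym (t , a∈ , b∈) = t , b∈ , a∈

-- Follows `crossesᵇ` connective by connective, including equality as in `eqᵇ`, because
-- `crosses-true` relies on definitional equality.
crosses : ℕ → ℕ → ℕ → ℕ → Form
crosses a b c d =
  ~ eq a c ⊓ᶠ ~ eq a d ⊓ᶠ ~ eq b c ⊓ᶠ ~ eq b d ⊓ᶠ (between a b c ⊕ between a b d)
  where
  eq : ℕ → ℕ → Form
  eq x y = ~ x ≺ y ⊓ᶠ ~ y ≺ x
  between : ℕ → ℕ → ℕ → Form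
  between p q r = (p ≺ r ⊓ᶠ r ≺ q) ⊕ (q ≺ r ⊓ᶠ r ≺ p)

count-map-filter : ∀ {A B : Set} {P : Pred B 0ℓ} {Q R : Pred A 0ℓ}
  (P? : Decidable P) (Q? : Decidable Q) (R? : Decidable R) (g : A → B) →
  (∀ {x} → Q x → P (g x) → R x) → ∀ xs → count P? (map g (filter Q? xs)) ≤ count R? xs
count-map-filter P? Q? R? g h [] = z≤n
count-map-filter P? Q? R? g h (x ∷ xs) with Q? x
... | no _ = ≤-trans (count-map-filter P? Q? R? g h xs) (count-∷ R? x xs)
... | yes q with P? (g x)
...   | no _ = ≤-trans (count-map-filter P? Q? R? g h xs) (count-∷ R? x xs)
...   | yes p rewrite count-yes R? {xs = xs} (h q p) = s≤s (count-map-filter P? Q? R? g h xs)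

count-unique : ∀ {A : Set} {P : Pred A 0ℓ} (P? : Decidable P) → (∀ {x y} → P x → P y → x ≡ y) →
  ∀ {xs} → Unique xs → count P? xs ≤ 1
count-unique P? unique [] = z≤n
count-unique P? unique {x ∷ xs} (x∉ ∷ u) with P? x
... | no  _ = count-unique P? unique u
... | yes p = s≤s (≤-reflexive (count-none P? xs λ y∈ q → All.lookup x∉ y∈ (unique p q)))

-- By injectivity each entry of `B` accounts for at most one element. This turns lengths of bags,
-- which may contain repetitions and the auxiliary positions `0` and `n + 1`, into bounds on numbers
-- of vertices.
count-members : ∀ {A : Set} {h : A → ℕ} → Injective _≡_ _≡_ h → ∀ B {xs} → Unique xs →
  count (λ x → h x ∈? B) xs ≤ length B
count-members {h = h} inj [] {xs} u = ≤-reflexive (count-none (λ x → h x ∈? []) xs λ _ ())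
count-members {h = h} inj (z ∷ B) {xs} u = ≤-trans
  (count-⊎ (λ x → h x ∈? (z ∷ B)) (λ x → h x ≟ z) (λ x → h x ∈? B) xs
    λ { _ (head eq) → inj₁ eq ; _ (tail m) → inj₂ m })
  (+-mono-≤ (count-unique (λ x → h x ≟ z) (λ p q → inj (trans p (≡-sym q))) u) (count-members inj B u))

∈-allPairs : ∀ {n} (c d : Fin n) → (c , d) ∈ allPairs n
∈-allPairs c d = ∈-concatMap⁺ _ (Any.map (λ { refl → ∈-map⁺ (c ,_) (∈-allFin d) }) (∈-allFin c))

module Drawing {n} (G : Graph n) (D : ConvexDrawing n) where

  -- Positions are shifted by one so that 0 and n + 1 form a chord below which everything lies.
  at : Fin n → ℕ
  at v = suc (toℕ (pos D v))

  at-injective : Injective _≡_ _≡_ at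
  at-injective eq = pos-inj D (Fin.toℕ-injective (suc-injective eq))

  isEdge : Fin n × Fin n → Bool
  isEdge (c , d) = ⌊ c Fin.<? d ⌋ ∧ adj G c d

  ordered : Fin n × Fin n → Edge
  ordered (c , d) = normalise (at c) (at d)

  es : List Edge
  es = map ordered (filterᵇ isEdge (allPairs n))

  ∈-es⁺ : ∀ {c d} → c Fin.< d → adj G c d ≡ true → ordered (c , d) ∈ es
  ∈-es⁺ {c} {d} c<d cd = ∈-map⁺ ordered (∈-filter⁺ (T? ∘ isEdge) (∈-allPairs c d)
    (Equivalence.from T-∧ (fromWitness {a? = c Fin.<? d} c<d , Equivalence.from T-≡ cd)))

  record Source (x y : ℕ) : Set where
    constructor source
    field
      {c d}  : Fin n
      c<d    : c Fin.< d
      joined : adj G c d ≡ true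
      spec   : Normal (at c) (at d) (x , y)

  ∈-es⁻ : ∀ {x y} → (x , y) ∈ es → Source x y
  ∈-es⁻ e∈ with ∈-map⁻ ordered e∈
  ... | (c , d) , cd∈ , eq
        with Equivalence.to T-∧ (proj₂ (∈-filter⁻ (T? ∘ isEdge) {xs = allPairs n} cd∈))
  ...   | c<d , cd = source {c = c} {d} (toWitness c<d) (Equivalence.to T-≡ cd)
            (subst (Normal (at c) (at d))
              (≡-sym eq) (normalise-spec (at c) (at d)))

  lo<hi : ∀ {x y} → (x , y) ∈ es → x < y
  lo<hi {x} {y} e∈ with ∈-es⁻ e∈
  ... | source {c} {d} c<d _ sp = order (normal 0 1 2 3 ⇒ ~ 0 ≈ 1 ⇒ 2 ≺ 3)
    (at c ∷ at d ∷ x ∷ y ∷ []) sp (λ eq → Fin.<-irrefl (at-injective eq) c<d)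

  below : ∀ {x y} → (x , y) ∈ es → 0 < x × y < suc n
  below {x} {y} e∈ with ∈-es⁻ e∈
  ... | source {c} {d} _ _ sp = order
    (normal 0 1 2 3 ⇒ 4 ≺ 0 ⇒ 4 ≺ 1 ⇒ 0 ≺ 5 ⇒ 1 ≺ 5 ⇒ 4 ≺ 2 ⊓ᶠ 3 ≺ 5)
    (at c ∷ at d ∷ x ∷ y ∷ 0 ∷ suc n ∷ []) sp z<s z<s (s<s (Fin.toℕ<n _)) (s<s (Fin.toℕ<n _))

  crosses-true : ∀ a b c d {x y g h} →
    Normal (at a) (at b) (x , y) →
    Normal (at c) (at d) (g , h) →
    Cross x y (g , h) → crossesᵇ D a b c d ≡ true
  crosses-true a b c d {x} {y} {g} {h} ab cd cr =
    evalᵇ-true (env (map (toℕ ∘ pos D) (a ∷ b ∷ c ∷ d ∷ []))) (crosses 0 1 2 3)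
      (order (normal 0 1 4 5 ⇒ normal 2 3 6 7 ⇒ cross 4 5 6 7 ⇒ crosses 0 1 2 3)
        (at a ∷ at b ∷ at c ∷ at d ∷ x ∷ y ∷ g ∷ h ∷ []) ab cd cr)

  -- Both counts range over the same pairs `c < d`, so it suffices that crossing normalised pairs
  -- cross in the drawing.
  cnt≤crossCount : ∀ a b {x y} →
    Normal (at a) (at b) (x , y) →
    crossings es x y ≤ crossCount G D a b
  cnt≤crossCount a b {x} {y} ab = count-map-filter (Cross? x y) (T? ∘ isEdge) (T? ∘ _) ordered
    (λ {(c , d)} e cr → let c<d , cd = Equivalence.to (T-∧ {⌊ c Fin.<? d ⌋}) e in
       Equivalence.from (T-∧ {⌊ c Fin.<? d ⌋}) (c<d , Equivalence.from (T-∧ {adj G c d}) (cd ,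
         Equivalence.from T-≡ (crosses-true a b c d ab (normalise-spec (at c) (at d)) cr))))
    (allPairs n)

  minPlanar : ∀ {k} → IsOuterMinKPlanarDrawing k G D →
    ∀ {a b x y} → (a , b) ∈ es → (x , y) ∈ es → Cross a b (x , y) →
    crossings es a b ≤ k ⊎ crossings es x y ≤ k
  minPlanar mp e∈ f∈ cr with ∈-es⁻ e∈ | ∈-es⁻ f∈
  ... | source {a} {b} _ ab sp | source {c} {d} _ cd sp′ =
    Sum.map (≤-trans (cnt≤crossCount a b sp)) (≤-trans (cnt≤crossCount c d sp′))
      (mp a b c d ab cd (crosses-true a b c d sp sp′ cr))

  module _ {K : ℕ} (mp : IsOuterMinKPlanarDrawing (suc K) G D) where
    open Filling es lo<hi K (minPlanar mp)

    uncrossed : ∀ {e} → e ∈ es → ¬ Cross 0 (suc n) e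
    uncrossed {x , y} e∈ = order (0 ≺ 2 ⊓ᶠ 3 ≺ 1 ⇒ 2 ≺ 3 ⇒ ~ cross 0 1 2 3)
      (0 ∷ suc n ∷ x ∷ y ∷ []) (below e∈) (lo<hi e∈)

    T₀ : Growth 0
    T₀ = single (0 ∷ suc n ∷ [])

    abstract
      -- No edge crosses the chord from `0` to `n + 1`, so its guard is just its two ends, and
      -- `proj₁` is an arbitrary initial choice of representatives.
      filled : Filled 0 (suc n) proj₁ T₀
      filled = fill (suc n) 0 (suc n) proj₁ (λ _ _ → inj₁ refl) ≤-refl z<s
        (≤-trans (≤-reflexive (count-none (Cross? 0 (suc n)) es uncrossed)) z≤n)
        T₀ zero (single-valid (s≤s (≤-trans (s≤s z≤n) (m≤n+m 1 (3 * suc K))))) guard⊆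
        (λ { _ _ (_ , head eq) → head eq ; _ _ (_ , tail (head eq)) → tail (head eq) })
        where
        guard⊆ : ∀ {z} → z ∈ guard 0 (suc n) proj₁ → z ∈ 0 ∷ suc n ∷ []
        guard⊆ (head eq) = head eq
        guard⊆ (tail (head eq)) = tail (head eq)
        guard⊆ (tail (tail z∈)) with ∈-ends⁻ proj₁ (Cross? 0 (suc n)) z∈
        ... | _ , e∈ , cr , _ = contradiction cr (uncrossed e∈)

    open Filled filled

    together-ordered : ∀ {c d} → c Fin.< d → adj G c d ≡ true → Together T′ (at c) (at d)
    together-ordered {c} {d} c<d cd = Together-normal T′ (normalise-spec (at c) (at d))
      (edges e∈ (inj₁ (z≤n , <⇒≤ (proj₂ (below e∈)) , inj₁ (proj₁ (below e∈)))))
      where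
      e∈ : ordered (c , d) ∈ es
      e∈ = ∈-es⁺ c<d cd

    together : ∀ {u v} → adj G u v ≡ true → Together T′ (at u) (at v)
    together {u} {v} uv with Fin.<-cmp u v
    ... | tri< u<v _ _  = together-ordered u<v uv
    ... | tri≈ _ refl _ = contradiction (trans (≡-sym uv) (irrefl G u)) λ ()
    ... | tri> _ _ v<u  = Together-sym {T = T′} (together-ordered v<u (trans (sym G v u) uv))

    decomposition : TreeDecomposition G (3 * suc K + 1)
    decomposition = record
      { m = m′
      ; tree = graphOf T′
      ; isTree = connected T′ , acyclic T′
      ; bag = λ t v → ⌊ at v ∈? bagOf T′ t ⌋
      ; cover-vertex = λ v → let t , v∈ = vertices z<s (s<s (Fin.toℕ<n (pos D v))) in t , ⌊⌋-true _ v∈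
      ; cover-edge = λ u v uv → let t , u∈ , v∈ = together uv in t , ⌊⌋-true _ u∈ , ⌊⌋-true _ v∈
      ; subtree = λ v s t v∈s v∈t → walk-map (⌊⌋-true _) (connects valid (at v) s t (true-⌊⌋ _ v∈s) (true-⌊⌋ _ v∈t))
      ; width = λ t → ≤-trans (count-⊆ (T? ∘ λ v → ⌊ at v ∈? bagOf T′ t ⌋) (λ v → at v ∈? bagOf T′ t) (allFin n) (λ _ → toWitness))
                  (≤-trans (count-members at-injective (bagOf T′ t) (allFin⁺ n)) (small valid t))
      }

theorem14 : (k : ℕ) → 1 ≤ k → {n : ℕ} (G : Graph n) →
    OuterMinKPlanar k G → TreewidthAtMost (3 * k + 1) G
theorem14 (suc K) _ G (D , mp) = Drawing.decomposition G D mp
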